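{- Let $f:\mathbb{Z}^n\to\mathbb{Z}\cup\{+\infty\}$ be an integer-valued integrally convex function, let $x\in\operatorname{dom}f$, and let $B$ be an integral box. If $\partial f(x)\cap B$ is nonempty, then $\partial f(x)\cap B$ is a polyhedron containing an integer vector. If, in addition, $\partial f(x)\cap B$ is bounded, then $\partial f(x)\cap B$ has an integral vertex.
   Context: $\operatorname{dom}f=\{x\in\mathbb{Z}^n\mid f(x)<+\infty\}$. Integral convexity: for $x\in\mathbb{R}^n$ let $N(x)=\{z\in\mathbb{Z}^n\mid |x_i-z_i|<1\ (i=1,\dots,n)\}$. For $f:\mathbb{Z}^n\to\mathbb{R}\cup\{+\infty\}$ with $\operatorname{dom}f\ne\emptyset$, the local convex extension is $\tilde f(x)=\min\{\sum_{y\in N(x)}\lambda_y f(y)\mid \sum_{y\in N(x)}\lambda_y y=x,\ \sum_{y\in N(x)}\lambda_y=1,\ \lambda_y\ge 0\ (y\in N(x))\}$ for $x\in\mathbb{R}^n$. The function $f$ is integrally convex if $\tilde f:\mathbb{R}^n\to\mathbb{R}\cup\{+\infty\}$ is convex. Subdifferential: for $x\in\operatorname{dom}f$, $\partial f(x)=\{p\in\mathbb{R}^n\mid f(y)-f(x)\ge\langle p,y-x\rangle\ \text{for all }y\in\mathbb{Z}^n\}$. An integral box is a set $B=\{p\in\mathbb{R}^n\mid\alpha\le p\le\beta\}$ with $\alpha\in(\mathbb{Z}\cup\{ -\infty\})^n$, $\beta\in(\mathbb{Z}\cup\{+\infty\})^n$, $\alpha\le\beta$ (componentwise). -}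

module Defs where

open import Level using (0ℓ)
open import Algebra.Bundles using (CommutativeRing)
import Algebra.Construct.NaturalChoice.Max as Max
import Algebra.Properties.Monoid.Mult as Mult
import Algebra.Properties.Monoid.Sum as Sum
open import Data.Fin.Base using (Fin)
open import Data.Integer.Base as ℤ using (ℤ; +_; -[1+_])
import Data.Maybe.Base as Maybe
open import Data.Nat.Base as ℕ using (ℕ)
open import Data.Product.Base using (_×_; ∃-syntax; Σ-syntax)
open import Data.Vec.Base as Vec using (Vec)
open import Data.Vec.Functional as Vector using (Vector)
open import Function.Base using (_∘_)
open import Function.Bundles using (_⇔_)
open import Function.Definitions using (Injective)
open import Relation.Binary.Bundles using (DecTotalOrder)
open import Relation.Binary.Core using (Rel)
open import Relation.Binary.PropositionalEquality.Core using (_≡_)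
open import Relation.Binary.Structures using (IsDecTotalOrder)
open import Relation.Nullary.Construct.Add.Infimum using (_₋)
open import Relation.Nullary.Construct.Add.Supremum using (_⁺; ⊤⁺; [_])
open import Relation.Nullary.Decidable.Core using (yes; no)
open import Relation.Nullary.Negation.Core using (¬_)
open import Relation.Unary using (Pred; _∈_; Satisfiable)
import Relation.Binary.Construct.Add.Extrema.NonStrict as ExtremaOrder
import Relation.Binary.Construct.Add.Infimum.NonStrict as InfimumOrder
import Relation.Binary.Construct.Add.Supremum.Equality as SupremumEquality
import Relation.Binary.Construct.Add.Supremum.NonStrict as SupremumOrder
import Relation.Binary.Construct.Add.Supremum.Strict as SupremumStrictOrder
import Relation.Binary.Construct.NonStrictToStrict as ToStrict

-- The real numbers are axiomatised as a Dedekind-complete totally ordered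
-- field, which determines them up to isomorphism.  The order is decidable, as
-- for the classical reals.
record RealNumbers : Set₁ where
  field
    commutativeRing : CommutativeRing 0ℓ 0ℓ

  open CommutativeRing commutativeRing public
    renaming (Carrier to ℝ)

  infix 4 _≤_
  field
    _≤_             : Rel ℝ 0ℓ
    isDecTotalOrder : IsDecTotalOrder _≈_ _≤_

    1≉0        : ¬ 1# ≈ 0#
    inverse    : ∀ x → ¬ x ≈ 0# → ∃[ y ] x * y ≈ 1#
    +-monoˡ-≤  : ∀ z {x y} → x ≤ y → x + z ≤ y + z
    *-nonNeg   : ∀ {x y} → 0# ≤ x → 0# ≤ y → 0# ≤ x * y

  UpperBound : Pred ℝ 0ℓ → Pred ℝ 0ℓ
  UpperBound S u = ∀ {x} → x ∈ S → x ≤ u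

  field
    supremum : (S : Pred ℝ 0ℓ) → Satisfiable S → Satisfiable (UpperBound S) →
               ∃[ s ] s ∈ UpperBound S × (∀ {u} → u ∈ UpperBound S → s ≤ u)

  decTotalOrder : DecTotalOrder 0ℓ 0ℓ 0ℓ
  decTotalOrder = record { isDecTotalOrder = isDecTotalOrder }

  open DecTotalOrder decTotalOrder public
    using (totalOrder; _≟_; _≤?_)

  open ToStrict _≈_ _≤_ public using (_<_)

  open Max totalOrder public using (_⊔_)

  open Sum +-monoid public using (sum; sum-syntax)

  open Mult +-monoid public using () renaming (_×_ to _×ℕ_)

  infix 8 ∣_∣
  ∣_∣ : ℝ → ℝ
  ∣ x ∣ = x ⊔ (- x)

  ι : ℤ → ℝ
  ι (+ m)    = m ×ℕ 1#
  ι -[1+ m ] = - (ℕ.suc m ×ℕ 1#)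

-- Lattice points are elements of Vec ℤ n rather than functions, so that
-- functions on them automatically respect their equality.
ℤ^ : ℕ → Set
ℤ^ n = Vec ℤ n

record IntegralBox (n : ℕ) : Set where
  open ExtremaOrder ℤ._≤_ using (_≤±_)
  field
    α   : Vector (ℤ ₋) n
    β   : Vector (ℤ ⁺) n
    -- The extended integers are (ℤ ₋) ⁺, so α i and β i embed as follows.
    α≤β : ∀ i → [ α i ] ≤± Maybe.map [_] (β i)

module IntegralConvexity (R : RealNumbers) where

  open RealNumbers R

  ℝ^ : ℕ → Set
  ℝ^ n = Vector ℝ n

  infix 4 _≋_
  _≋_ : ∀ {n} → Rel (ℝ^ n) 0ℓ
  x ≋ y = ∀ i → x i ≈ y i

  ⟨_,_⟩ : ∀ {n} → ℝ^ n → ℝ^ n → ℝ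
  ⟨ p , x ⟩ = sum λ i → p i * x i

  infixl 6 _⊖_
  _⊖_ : ∀ {n} → ℝ^ n → ℝ^ n → ℝ^ n
  (x ⊖ y) i = x i - y i

  mix : ∀ {n} → ℝ → ℝ^ n → ℝ^ n → ℝ^ n
  mix t x y i = t * x i + (1# - t) * y i

  ι^ : ∀ {n} → ℤ^ n → ℝ^ n
  ι^ z i = ι (Vec.lookup z i)

  open SupremumEquality _≈_ public using (_≈⁺_)
  open SupremumOrder _≤_ public using (_≤⁺_)
  open SupremumStrictOrder _<_ public using (_<⁺_; [_]<⊤⁺)
  open InfimumOrder _≤_ public using (_≤₋_)

  infixl 6 _+⁺_ _-⁺_
  infixl 7 _·⁺_

  _+⁺_ : ℝ ⁺ → ℝ ⁺ → ℝ ⁺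
  [ a ] +⁺ [ b ] = [ a + b ]
  [ _ ] +⁺ ⊤⁺    = ⊤⁺
  ⊤⁺    +⁺ _     = ⊤⁺

  _-⁺_ : ℝ ⁺ → ℝ → ℝ ⁺
  a -⁺ b = a +⁺ [ - b ]

  -- Used only for nonnegative scalars, with the convention 0 · (+∞) = 0.
  _·⁺_ : ℝ → ℝ ⁺ → ℝ ⁺
  t ·⁺ [ a ] = [ t * a ]
  t ·⁺ ⊤⁺ with t ≟ 0#
  ... | yes _ = [ 0# ]
  ... | no  _ = ⊤⁺

  sum⁺ : ∀ {k} → Vector (ℝ ⁺) k → ℝ ⁺
  sum⁺ = Vector.foldr _+⁺_ [ 0# ]

  dom : ∀ {n} → (ℤ^ n → ℝ ⁺) → Pred (ℤ^ n) 0ℓ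
  dom f x = f x <⁺ ⊤⁺

  finiteValue : ∀ {a} → a <⁺ ⊤⁺ → ℝ
  finiteValue [ a ]<⊤⁺ = a

  N : ∀ {n} → ℝ^ n → Pred (ℤ^ n) 0ℓ
  N x z = ∀ i → ∣ x i - ι (Vec.lookup z i) ∣ < 1#

  -- A listing without repetition of a set of lattice points, over which sums
  -- indexed by that set are taken.
  record Enumeration {n} (S : Pred (ℤ^ n) 0ℓ) : Set where
    field
      size       : ℕ
      point      : Fin size → ℤ^ n
      injective  : Injective _≡_ _≡_ point
      sound      : ∀ j → point j ∈ S
      surjective : ∀ {z} → z ∈ S → ∃[ j ] point j ≡ z

  record ConvexCombination {n} (x : ℝ^ n) : Set where
    field
      enumeration : Enumeration (N x)
    open Enumeration enumeration public
    field
      weight     : Vector ℝ size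
      barycentre : (λ i → ∑[ j < size ] (weight j * ι^ (point j) i)) ≋ x
      total      : sum weight ≈ 1#
      nonNeg     : ∀ j → 0# ≤ weight j

    value : (ℤ^ n → ℝ ⁺) → ℝ ⁺
    value f = sum⁺ λ j → weight j ·⁺ f (point j)

  IsMinimum : Pred (ℝ ⁺) 0ℓ → ℝ ⁺ → Set
  IsMinimum S m = m ∈ S × (∀ {v} → v ∈ S → m ≤⁺ v)

  LocalValues : ∀ {n} → (ℤ^ n → ℝ ⁺) → ℝ^ n → Pred (ℝ ⁺) 0ℓ
  LocalValues f x v = ∃[ c ] v ≈⁺ ConvexCombination.value {x = x} c f

  IsLocalConvexExtension : ∀ {n} → (ℤ^ n → ℝ ⁺) → (ℝ^ n → ℝ ⁺) → Set
  IsLocalConvexExtension f f̃ = ∀ x → IsMinimum (LocalValues f x) (f̃ x)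

  Convex : ∀ {n} → (ℝ^ n → ℝ ⁺) → Set
  Convex g = ∀ x y t → 0# ≤ t → t ≤ 1# →
             g (mix t x y) ≤⁺ t ·⁺ g x +⁺ (1# - t) ·⁺ g y

  -- The minimum defining the local convex extension always exists, as N x is
  -- finite and its convex hull contains x, and is unique up to _≈⁺_.  Hence
  -- "the" extension is convex iff some function with its property is convex.
  IntegrallyConvex : ∀ {n} → (ℤ^ n → ℝ ⁺) → Set
  IntegrallyConvex f =
    Satisfiable (dom f) × ∃[ f̃ ] IsLocalConvexExtension f f̃ × Convex f̃

  ∂ : ∀ {n} (f : ℤ^ n → ℝ ⁺) (x : ℤ^ n) → x ∈ dom f → Pred (ℝ^ n) 0ℓ
  ∂ f x x∈dom p =
    ∀ y → [ ⟨ p , ι^ y ⊖ ι^ x ⟩ ] ≤⁺ f y -⁺ finiteValue x∈dom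

  ⟦_⟧ : ∀ {n} → IntegralBox n → Pred (ℝ^ n) 0ℓ
  ⟦ B ⟧ p = ∀ i → Maybe.map ι (α i) ≤₋ [ p i ] × [ p i ] ≤⁺ Maybe.map ι (β i)
    where open IntegralBox B

  toReal : ∀ {n} → (ℤ^ n → ℤ ⁺) → ℤ^ n → ℝ ⁺
  toReal f = Maybe.map ι ∘ f

  IsPolyhedron : ∀ {n} → Pred (ℝ^ n) 0ℓ → Set
  IsPolyhedron {n} P =
    ∃[ m ] Σ[ A ∈ Vector (ℝ^ n) m ] Σ[ b ∈ Vector ℝ m ]
      (∀ p → p ∈ P ⇔ (∀ k → ⟨ A k , p ⟩ ≤ b k))

  Bounded : ∀ {n} → Pred (ℝ^ n) 0ℓ → Set
  Bounded P = ∃[ M ] (∀ {p} → p ∈ P → ∀ i → ∣ p i ∣ ≤ M)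

  IsVertex : ∀ {n} → Pred (ℝ^ n) 0ℓ → ℝ^ n → Set
  IsVertex P v =
    v ∈ P ×
    (∀ {p q t} → p ∈ P → q ∈ P → 0# < t → t < 1# →
     v ≋ mix t p q → p ≋ v × q ≋ v)

{-# OPTIONS --safe #-}

-- The subgradients of f at x are cut out by the inequalities in the
-- directions y ∈ {-1, 0, 1}ⁿ: a point close to x on the segment from x to any
-- z has all its lattice neighbours of the form x + y, so an affine minorant
-- there extends to z. Fourier–Motzkin elimination of a coordinate keeps this
-- shape. Combining the rows (1, a) and (-1, b) gives nothing new, since
-- integral convexity bounds f at the midpoint by rows with first entry 0;
-- combining a row with a bound merely shifts its integral right-hand side,
-- and the class of systems that are convex at midpoints is preserved. Hence
-- the bounds on each eliminated coordinate, given integral values of the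
-- others, are integral and compatible, which yields an integral point.
-- Taking the upper bound in every step (it exists if the polyhedron is
-- bounded) yields a vertex.

module Submission where

open import Defs
import Algebra.Construct.NaturalChoice.Max as Max
import Algebra.Properties.Ring as RingProperties
import Algebra.Properties.Semiring.Mult as Mult
import Algebra.Properties.Semiring.Sum as Sums
import Algebra.Solver.Ring as RingSolver
open import Algebra.Solver.Ring.AlmostCommutativeRing
  using (fromCommutativeRing; _-Raw-AlmostCommutative⟶_; Induced-equivalence)
open import Data.Fin.Base using (Fin; zero; suc)
open import Data.Integer.Base as ℤ using (ℤ; +_; -[1+_]; 0ℤ; 1ℤ; -1ℤ)
import Data.Integer.Properties as ℤₚ
open import Data.Integer.Tactic.RingSolver using (solve-∀)
open import Data.List.Base as List using (List; []; _∷_; mapMaybe; fromMaybe; cartesianProductWith)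
open import Data.List.Extrema ℤₚ.≤-totalOrder
  using (min; max; min≤⊤; min≤xs; argmin-sel; ⊥≤max; xs≤max)
open import Data.List.Membership.Propositional using () renaming (_∈_ to _∈ˡ_)
open import Data.List.Membership.Propositional.Properties
  using (∈-++⁺ˡ; ∈-++⁺ʳ; ∈-++⁻; ∈-cartesianProductWith⁺; ∈-lookup)
open import Data.List.Relation.Unary.All as All using (All; []; _∷_)
import Data.List.Relation.Unary.All.Properties as Allₚ
open import Data.List.Relation.Unary.Any as Any using (here; there)
open import Data.List.Relation.Unary.Any.Properties using (lookup-index)
open import Data.Maybe.Base as Maybe using (Maybe; just; nothing)
open import Data.Maybe.Properties using (just-injective)
open import Data.Nat.Base as ℕ using (ℕ; s≤s; z≤n)
import Data.Nat.Properties as ℕₚ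
open import Data.Product.Base using (_×_; _,_; ∃-syntax; proj₁; proj₂)
open import Data.Sum.Base as Sum using (_⊎_; inj₁; inj₂)
open import Data.Vec.Base using (Vec; []; _∷_; lookup; zipWith)
open import Data.Vec.Functional as Vector using (Vector)
open import Data.Vec.Properties using (lookup-zipWith; tabulate∘lookup; tabulate-cong)
open import Function.Base using (id; _∘_)
open import Function.Bundles using (_⇔_; mk⇔; Equivalence)
open import Level using (0ℓ)
import Relation.Binary.Construct.Add.Infimum.NonStrict as IO
import Relation.Binary.Construct.Add.Supremum.Equality as SE
import Relation.Binary.Construct.Add.Supremum.NonStrict as SO
import Relation.Binary.Construct.Add.Supremum.Strict as SS
open import Relation.Binary.Definitions using (WeaklyDecidable)
open import Relation.Binary.PropositionalEquality.Core as ≡ using (_≡_)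
import Relation.Binary.Reasoning.Setoid as SetoidReasoning
open import Relation.Binary.Structures using (IsDecTotalOrder)
open import Relation.Nullary.Construct.Add.Infimum using (_₋)
open import Relation.Nullary.Construct.Add.Supremum using (_⁺; ⊤⁺)
open import Relation.Nullary.Decidable.Core using (yes; no)
open import Relation.Nullary.Negation.Core using (¬_; contradiction)
open import Relation.Unary using (Pred; _∈_; _∩_; Satisfiable)

private variable
  n : ℕ

-- Integral Fourier-Motzkin elimination with coefficients -1, 0, 1

module Elimination where

  open import Data.Integer.Base using (_+_; _-_; _*_; -_; _≤_)
  open import Relation.Binary.PropositionalEquality.Core using (refl; sym; cong; cong₂; subst)

  data Trit : Set where
    −1ₜ 0ₜ 1ₜ : Trit

  toℤ : Trit → ℤ
  toℤ −1ₜ = -1ℤ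
  toℤ 0ₜ  = 0ℤ
  toℤ 1ₜ  = 1ℤ

  infixl 7 _·_
  _·_ : ℤ^ n → Vec Trit n → ℤ
  []      · []      = 0ℤ
  (p ∷ z) · (s ∷ y) = p * toℤ s + z · y

  -- A row (y , v) stands for the inequality z · y ≤ v.
  Row System : ℕ → Set
  Row n    = Vec Trit n × ℤ
  System n = List (Row n)

  -- |(s + t) / 2 - r| < 1
  Close : Trit → Trit → Trit → Set
  Close r s t = ℤ.∣ toℤ s + toℤ t - (toℤ r + toℤ r) ∣ ℕ.< 2

  Near : (y a b : Vec Trit n) → Set
  Near y a b = ∀ i → Close (lookup y i) (lookup a i) (lookup b i)

  -- The inequality f̃ ((a + b) / 2) ≤ (f a + f b) / 2, dualised: every affine
  -- minorant of f near (a + b) / 2 obeys it.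
  MidpointConvex : System n → Set
  MidpointConvex S = ∀ {a u b v} → (a , u) ∈ˡ S → (b , v) ∈ˡ S → ∀ p c →
    (∀ {y w} → (y , w) ∈ˡ S → Near y a b → p · y + c ≤ w) →
    (p · a + c) + (p · b + c) ≤ u + v

  Consistent : ℤ ₋ → ℤ ⁺ → Set
  Consistent a b = ∀ {k l} → a ≡ just k → b ≡ just l → k ≤ l

  WithinBounds : ℤ ₋ → ℤ ⁺ → ℤ → Set
  WithinBounds a b z = (∀ {k} → a ≡ just k → k ≤ z) × (∀ {l} → b ≡ just l → z ≤ l)

  record Solution (S : System n) (α : Vector (ℤ ₋) n) (β : Vector (ℤ ⁺) n) (z : ℤ^ n) : Set where
    constructor solves
    field
      rows   : ∀ {y v} → (y , v) ∈ˡ S → z · y ≤ v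
      bounds : ∀ i → WithinBounds (α i) (β i) (lookup z i)

  open Solution

  -- The minimum of p * toℤ s over a ≤ p ≤ b, where nothing stands for -∞.
  leastValue : ℤ ₋ → ℤ ⁺ → Trit → Maybe ℤ
  leastValue a b −1ₜ = Maybe.map (λ l → - l) b
  leastValue a b 0ₜ  = just 0ℤ
  leastValue a b 1ₜ  = a

  eliminateRow : ℤ ₋ → ℤ ⁺ → Row (ℕ.suc n) → Maybe (Row n)
  eliminateRow a b (s ∷ y , v) = Maybe.map (λ d → y , v - d) (leastValue a b s)

  -- A row is combined at most with a bound on the first coordinate, and disappears if the bound it
  -- calls for is infinite. The combinations of two rows with opposite first entries, usual in
  -- Fourier-Motzkin elimination, are left out because midpoint convexity implies them; see
  -- `lower≤upper`.
  eliminate : ℤ ₋ → ℤ ⁺ → System (ℕ.suc n) → System n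
  eliminate a b = mapMaybe (eliminateRow a b)

  private
    -- Turns a deduction between linear inequalities into a ring identity between their slacks,
    -- which a solver can check.
    ≤-via-difference : ∀ {a b c d} → a ≤ b → b - a ≡ d - c → c ≤ d
    ≤-via-difference a≤b eq = ℤₚ.0≤i-j⇒j≤i (subst (0ℤ ≤_) eq (ℤₚ.i≤j⇒0≤j-i a≤b))

  module _ {A B : Set} {f : A → Maybe B} where

    ∈-mapMaybe⁺ : ∀ {xs x y} → x ∈ˡ xs → f x ≡ just y → y ∈ˡ mapMaybe f xs
    ∈-mapMaybe⁺ {x′ ∷ xs} (here refl) eq with just _ ← f x′ = here (sym (just-injective eq))
    ∈-mapMaybe⁺ {x′ ∷ xs} (there x∈xs) eq with f x′
    ... | just _  = there (∈-mapMaybe⁺ x∈xs eq)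
    ... | nothing = ∈-mapMaybe⁺ x∈xs eq

    ∈-mapMaybe⁻ : ∀ xs {y} → y ∈ˡ mapMaybe f xs → ∃[ x ] x ∈ˡ xs × f x ≡ just y
    ∈-mapMaybe⁻ (x ∷ xs) y∈ with f x in eq | y∈
    ... | nothing | y∈xs       = let x′ , x′∈xs , eq′ = ∈-mapMaybe⁻ xs y∈xs in x′ , there x′∈xs , eq′
    ... | just _  | there y∈xs = let x′ , x′∈xs , eq′ = ∈-mapMaybe⁻ xs y∈xs in x′ , there x′∈xs , eq′
    ... | just _  | here refl  = x , here refl , eq

  ∈-fromMaybe⁺ : ∀ {A : Set} {m : Maybe A} {x} → m ≡ just x → x ∈ˡ fromMaybe m
  ∈-fromMaybe⁺ refl = here refl

  ∈-fromMaybe⁻ : ∀ {A : Set} {m : Maybe A} {x} → x ∈ˡ fromMaybe m → m ≡ just x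
  ∈-fromMaybe⁻ {m = just _} (here refl) = refl

  module _ {a : ℤ ₋} {b : ℤ ⁺} where

    ∈-eliminate⁺ : ∀ {S : System (ℕ.suc n)} {s y v d} → (s ∷ y , v) ∈ˡ S →
                   leastValue a b s ≡ just d → (y , v - d) ∈ˡ eliminate a b S
    ∈-eliminate⁺ {y = y} {v} ∈S eq = ∈-mapMaybe⁺ ∈S (cong (Maybe.map λ d → y , v - d) eq)

    ∈-eliminate⁻ : ∀ (S : System (ℕ.suc n)) {y w} → (y , w) ∈ˡ eliminate a b S →
                   ∃[ s ] ∃[ v ] ∃[ d ] (s ∷ y , v) ∈ˡ S × leastValue a b s ≡ just d × w ≡ v - d
    ∈-eliminate⁻ S ∈H with ∈-mapMaybe⁻ S ∈H
    ... | (s ∷ y , v) , ∈S , eq with leastValue a b s in eq′ | eq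
    ...   | just d | refl = s , v , d , ∈S , eq′ , refl

  private
    k≡k*1 : ∀ k → k ≡ k * 1ℤ
    k≡k*1 = solve-∀

    -k≡k*-1 : ∀ k → - k ≡ k * -1ℤ
    -k≡k*-1 = solve-∀

    0≡k*0 : ∀ k → 0ℤ ≡ k * 0ℤ
    0≡k*0 = solve-∀

    far : ∀ {A : Set} {m} → ℕ.suc (ℕ.suc m) ℕ.< 2 → A
    far (s≤s (s≤s ()))

  -- leastValue is the restriction of a convex function that is linear on
  -- [-1 , 0] and on [0 , 1].
  supportingSlope : ∀ {a b} → Consistent a b → ∀ s t {d e} →
    leastValue a b s ≡ just d → leastValue a b t ≡ just e →
    ∃[ k ] (∀ r → Close r s t → leastValue a b r ≡ just (k * toℤ r)) ×
           d + e ≤ k * toℤ s + k * toℤ t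
  supportingSlope _ 1ₜ 1ₜ {k} refl refl =
    k , (λ { 1ₜ _ → cong just (k≡k*1 k) ; 0ₜ → far ; −1ₜ → far }) ,
    ℤₚ.≤-reflexive (cong₂ _+_ (k≡k*1 k) (k≡k*1 k))
  supportingSlope _ 1ₜ 0ₜ {k} refl refl =
    k , (λ { 1ₜ _ → cong just (k≡k*1 k) ; 0ₜ _ → cong just (0≡k*0 k) ; −1ₜ → far }) ,
    ℤₚ.≤-reflexive (cong₂ _+_ (k≡k*1 k) (0≡k*0 k))
  supportingSlope _ 0ₜ 1ₜ {_} {k} refl refl =
    k , (λ { 1ₜ _ → cong just (k≡k*1 k) ; 0ₜ _ → cong just (0≡k*0 k) ; −1ₜ → far }) ,
    ℤₚ.≤-reflexive (cong₂ _+_ (0≡k*0 k) (k≡k*1 k))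
  supportingSlope _ 0ₜ 0ₜ refl refl =
    0ℤ , (λ { 1ₜ → far ; 0ₜ _ → refl ; −1ₜ → far }) , ℤₚ.≤-refl
  supportingSlope {b = just k} _ −1ₜ −1ₜ refl refl =
    k , (λ { −1ₜ _ → cong just (-k≡k*-1 k) ; 0ₜ → far ; 1ₜ → far }) ,
    ℤₚ.≤-reflexive (cong₂ _+_ (-k≡k*-1 k) (-k≡k*-1 k))
  supportingSlope {b = just k} _ −1ₜ 0ₜ refl refl =
    k , (λ { −1ₜ _ → cong just (-k≡k*-1 k) ; 0ₜ _ → cong just (0≡k*0 k) ; 1ₜ → far }) ,
    ℤₚ.≤-reflexive (cong₂ _+_ (-k≡k*-1 k) (0≡k*0 k))
  supportingSlope {b = just k} _ 0ₜ −1ₜ refl refl =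
    k , (λ { −1ₜ _ → cong just (-k≡k*-1 k) ; 0ₜ _ → cong just (0≡k*0 k) ; 1ₜ → far }) ,
    ℤₚ.≤-reflexive (cong₂ _+_ (0≡k*0 k) (-k≡k*-1 k))
  -- Opposite entries have the kink 0 as their midpoint, and 0 is the only close entry, so slope 0
  -- will do. The inequality left over is `a - b ≤ 0`, that is, consistency of the two bounds.
  supportingSlope {b = just _} a≤b 1ₜ −1ₜ refl refl =
    0ℤ , (λ { −1ₜ → far ; 0ₜ _ → refl ; 1ₜ → far }) , ℤₚ.i≤j⇒i-j≤0 (a≤b refl refl)
  supportingSlope {b = just b} a≤b −1ₜ 1ₜ {_} {a} refl refl =
    0ℤ , (λ { −1ₜ → far ; 0ₜ _ → refl ; 1ₜ → far }) ,
    subst (_≤ 0ℤ) (ℤₚ.+-comm a (- b)) (ℤₚ.i≤j⇒i-j≤0 (a≤b refl refl))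

  -- A minorant `p`, `c` of the eliminated system lifts to `k ∷ p`, `c`, where `k` is a supporting
  -- slope of `leastValue` at the midpoint of the two first entries. On rows near the midpoint,
  -- elimination subtracts exactly `k * toℤ r`, so the lift is a minorant of `S`. Midpoint convexity
  -- of `S` and `d + e ≤ k * toℤ s + k * toℤ t` then add up to the claim.
  eliminate-midpointConvex : ∀ {a b} {S : System (ℕ.suc n)} → Consistent a b →
                             MidpointConvex S → MidpointConvex (eliminate a b S)
  eliminate-midpointConvex {S = S} a≤b convex {x} {_} {x′} ∈H ∈H′ p c minorant
    with s , v , d , ∈S , s↦d , refl ← ∈-eliminate⁻ S ∈H
    with t , w , e , ∈S′ , t↦e , refl ← ∈-eliminate⁻ S ∈H′
    with k , linear , d+e≤ ← supportingSlope a≤b s t s↦d t↦e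
    = ≤-via-difference
        (ℤₚ.+-mono-≤ (convex ∈S ∈S′ (k ∷ p) c minorant′) d+e≤)
        (sides (k * toℤ s) (k * toℤ t) (p · x) (p · x′) c v w d e)
    where
    minorant′ : ∀ {y u} → (y , u) ∈ˡ S → Near y (s ∷ x) (t ∷ x′) → (k ∷ p) · y + c ≤ u
    minorant′ {r ∷ y} {u} ∈S″ near = ≤-via-difference
      (minorant (∈-eliminate⁺ ∈S″ (linear r (near zero))) (near ∘ suc))
      (sides′ (k * toℤ r) (p · y) c u)
      where
      sides′ : ∀ kr q c u → u - kr - (q + c) ≡ u - (kr + q + c)
      sides′ = solve-∀

    sides : ∀ ks kt q q′ c v w d e →
            v + w + (ks + kt) - (ks + q + c + (kt + q′ + c) + (d + e)) ≡
            v - d + (w - e) - (q + c + (q′ + c))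
    sides = solve-∀

  -- Remembers which inequality caps the first coordinate at `z₁` over `z`: the box bound or a row
  -- with first entry 1. The origin matters because the same inequality also caps real solutions,
  -- which extremality requires.
  Tight : System (ℕ.suc n) → ℤ ⁺ → ℤ → ℤ^ n → Set
  Tight S b z₁ z = b ≡ just z₁ ⊎ ∃[ y ] ∃[ v ] (1ₜ ∷ y , v) ∈ˡ S × z₁ ≡ v - z · y

  -- Integral fibres over a solution of the eliminated system

  module Fibre {S : System (ℕ.suc n)}
               {α : Vector (ℤ ₋) (ℕ.suc n)} {β : Vector (ℤ ⁺) (ℕ.suc n)}
               (a≤b : Consistent (Vector.head α) (Vector.head β))
               (convex : MidpointConvex S) {z : ℤ^ n}
               (solution : Solution (eliminate (Vector.head α) (Vector.head β) S)
                                    (Vector.tail α) (Vector.tail β) z) where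

    private
      a = Vector.head α
      b = Vector.head β

      upper lower : Row (ℕ.suc n) → Maybe ℤ
      upper (1ₜ ∷ y , v) = just (v - z · y)
      upper _            = nothing
      lower (−1ₜ ∷ y , v) = just (z · y - v)
      lower _             = nothing

    uppers lowers : List ℤ
    uppers = fromMaybe b List.++ mapMaybe upper S
    lowers = fromMaybe a List.++ mapMaybe lower S

    uppers-tight : ∀ {u} → u ∈ˡ uppers → Tight S b u z
    uppers-tight u∈ with ∈-++⁻ (fromMaybe b) u∈
    ... | inj₁ u∈b = inj₁ (∈-fromMaybe⁻ u∈b)
    ... | inj₂ u∈S with ∈-mapMaybe⁻ S u∈S
    ...   | (1ₜ ∷ y , v) , ∈S , refl = inj₂ (y , v , ∈S , refl)

    lowers-tight : ∀ {l} → l ∈ˡ lowers →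
                   a ≡ just l ⊎ ∃[ y ] ∃[ v ] (−1ₜ ∷ y , v) ∈ˡ S × l ≡ z · y - v
    lowers-tight l∈ with ∈-++⁻ (fromMaybe a) l∈
    ... | inj₁ l∈a = inj₁ (∈-fromMaybe⁻ l∈a)
    ... | inj₂ l∈S with ∈-mapMaybe⁻ S l∈S
    ...   | (−1ₜ ∷ y , v) , ∈S , refl = inj₂ (y , v , ∈S , refl)

    -- If a box bound is involved, this is consistency of the box or a row of the eliminated system.
    -- For two rows, the first entries -1 and 1 have midpoint 0, so all rows near the midpoint start
    -- with 0. Elimination leaves those unchanged, so `z` satisfies them and `0ℤ ∷ z` with constant
    -- 0 is a minorant to which midpoint convexity applies.
    lower≤upper : ∀ {l u} → l ∈ˡ lowers → u ∈ˡ uppers → l ≤ u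
    lower≤upper l∈ u∈ with lowers-tight l∈ | uppers-tight u∈
    ... | inj₁ a≡l | inj₁ b≡u = a≤b a≡l b≡u
    ... | inj₁ a≡l | inj₂ (y , v , ∈S , refl) = ≤-via-difference
      (rows solution (∈-eliminate⁺ ∈S a≡l)) (sides _ v (z · y))
      where
      sides : ∀ l v q → v - l - q ≡ v - q - l
      sides = solve-∀
    ... | inj₂ (y , v , ∈S , refl) | inj₁ b≡u = ≤-via-difference
      (rows solution (∈-eliminate⁺ ∈S (cong (Maybe.map λ l → - l) b≡u))) (sides _ v (z · y))
      where
      sides : ∀ u v q → v - - u - q ≡ u - (q - v)
      sides = solve-∀
    ... | inj₂ (y , v , ∈S , refl) | inj₂ (y′ , v′ , ∈S′ , refl) = ≤-via-difference
      (convex ∈S ∈S′ (0ℤ ∷ z) 0ℤ minorant) (sides v v′ (z · y) (z · y′))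
      where
      sides : ∀ v v′ q q′ → v + v′ - (0ℤ * -1ℤ + q + 0ℤ + (0ℤ * 1ℤ + q′ + 0ℤ)) ≡ v′ - q′ - (q - v)
      sides = solve-∀

      minorant : ∀ {x w} → (x , w) ∈ˡ S → Near x (−1ₜ ∷ y) (1ₜ ∷ y′) → (0ℤ ∷ z) · x + 0ℤ ≤ w
      minorant {0ₜ ∷ x} {w} ∈S near = ≤-via-difference
        (rows solution (∈-eliminate⁺ {a = a} {b = b} ∈S refl)) (sides′ w (z · x))
        where
        sides′ : ∀ w q → w - 0ℤ - q ≡ w - (0ℤ * 0ℤ + q + 0ℤ)
        sides′ = solve-∀
      minorant {−1ₜ ∷ x} ∈S near = far (near zero)
      minorant {1ₜ ∷ x} ∈S near = far (near zero)

    extension : ∀ z₁ → (∀ {l} → l ∈ˡ lowers → l ≤ z₁) → (∀ {u} → u ∈ˡ uppers → z₁ ≤ u) →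
                Solution S α β (z₁ ∷ z)
    extension z₁ ≥lowers ≤uppers = solves rows′ bounds′
      where
      rows′ : ∀ {y v} → (y , v) ∈ˡ S → (z₁ ∷ z) · y ≤ v
      rows′ {1ₜ ∷ y} {v} ∈S = ≤-via-difference
        (≤uppers (∈-++⁺ʳ (fromMaybe b) (∈-mapMaybe⁺ ∈S refl))) (sides z₁ v (z · y))
        where
        sides : ∀ z₁ v q → v - q - z₁ ≡ v - (z₁ * 1ℤ + q)
        sides = solve-∀
      rows′ {−1ₜ ∷ y} {v} ∈S = ≤-via-difference
        (≥lowers (∈-++⁺ʳ (fromMaybe a) (∈-mapMaybe⁺ ∈S refl))) (sides z₁ v (z · y))
        where
        sides : ∀ z₁ v q → z₁ - (q - v) ≡ v - (z₁ * -1ℤ + q)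
        sides = solve-∀
      rows′ {0ₜ ∷ y} {v} ∈S = ≤-via-difference
        (rows solution (∈-eliminate⁺ {a = a} {b = b} ∈S refl)) (sides z₁ v (z · y))
        where
        sides : ∀ z₁ v q → v - 0ℤ - q ≡ v - (z₁ * 0ℤ + q)
        sides = solve-∀

      bounds′ : ∀ i → WithinBounds (α i) (β i) (lookup (z₁ ∷ z) i)
      bounds′ zero    = (λ a≡k → ≥lowers (∈-++⁺ˡ (∈-fromMaybe⁺ a≡k))) ,
                       (λ b≡l → ≤uppers (∈-++⁺ˡ (∈-fromMaybe⁺ b≡l)))
      bounds′ (suc i) = bounds solution i

    -- The least of the upper limits is an integer and attains one of them, which makes it tight. If
    -- there are no upper limits, every value above all lower limits is allowed, so the fibre is
    -- unbounded above.
    largestExtension : (∃[ z₁ ] Solution S α β (z₁ ∷ z) × Tight S b z₁ z) ⊎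
                       (∀ k → ∃[ z₁ ] k ≤ z₁ × Solution S α β (z₁ ∷ z))
    largestExtension with uppers in eq
    ... | [] = inj₂ λ k → max k lowers , ⊥≤max k lowers ,
               extension _ (All.lookup (xs≤max k lowers)) λ u∈ → empty (subst (_ ∈ˡ_) eq u∈)
      where
      empty : ∀ {u} {A : Set} → u ∈ˡ [] → A
      empty ()
    ... | u ∷ us = inj₁ (m , extension m (λ l∈ → lower≤upper l∈ m∈) m≤uppers , uppers-tight m∈)
      where
      m = min u us
      m∈ : m ∈ˡ uppers
      m∈ rewrite eq = Sum.[ here , there ]′ (argmin-sel id u us)
      m≤uppers : ∀ {u} → u ∈ˡ uppers → m ≤ u
      m≤uppers u∈ with subst (_ ∈ˡ_) eq u∈
      ... | here refl = min≤⊤ u us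
      ... | there u∈us = All.lookup (min≤xs u us) u∈us

    extensible : ∃[ z₁ ] Solution S α β (z₁ ∷ z)
    extensible with largestExtension
    ... | inj₁ (z₁ , solution′ , _) = z₁ , solution′
    ... | inj₂ above                = let z₁ , _ , solution′ = above 0ℤ in z₁ , solution′

open Elimination

-- The integers in the reals, and arithmetic of the ordered field

module RealFacts (R : RealNumbers) where

  open RealNumbers R
  open IsDecTotalOrder isDecTotalOrder public using () renaming
    (refl to ≤-refl; reflexive to ≤-reflexive; trans to ≤-trans; antisym to ≤-antisym; total to ≤-total)
  open RingProperties ring using (-0#≈0#; -‿+-comm; -‿distribˡ-*; -‿involutive)
  open Mult semiring using (×-homo-+; ×-homo-1)
  open SetoidReasoning setoid

  ι-⊖ : ∀ m n → ι (m ℤ.⊖ n) ≈ ι (+ m) - ι (+ n)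
  ι-⊖ m ℕ.zero = begin
    ι (+ m)      ≈⟨ +-identityʳ _ ⟨
    ι (+ m) + 0# ≈⟨ +-congˡ -0#≈0# ⟨
    ι (+ m) - 0# ∎
  ι-⊖ ℕ.zero (ℕ.suc n) = sym (+-identityˡ _)
  ι-⊖ (ℕ.suc m) (ℕ.suc n) = begin
    ι (ℕ.suc m ℤ.⊖ ℕ.suc n)             ≡⟨ ≡.cong ι (ℤₚ.[1+m]⊖[1+n]≡m⊖n m n) ⟩
    ι (m ℤ.⊖ n)                         ≈⟨ ι-⊖ m n ⟩
    ι (+ m) - ι (+ n)                   ≈⟨ +-congʳ (+-identityˡ _) ⟨
    0# + ι (+ m) - ι (+ n)              ≈⟨ +-congʳ (+-congʳ (-‿inverseʳ 1#)) ⟨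
    1# - 1# + ι (+ m) - ι (+ n)         ≈⟨ +-congʳ (+-assoc _ _ _) ⟩
    1# + (- 1# + ι (+ m)) - ι (+ n)     ≈⟨ +-congʳ (+-congˡ (+-comm _ _)) ⟩
    1# + (ι (+ m) - 1#) - ι (+ n)       ≈⟨ +-congʳ (+-assoc _ _ _) ⟨
    1# + ι (+ m) - 1# - ι (+ n)         ≈⟨ +-assoc _ _ _ ⟩
    1# + ι (+ m) + (- 1# - ι (+ n))     ≈⟨ +-congˡ (-‿+-comm _ _) ⟩
    1# + ι (+ m) - (1# + ι (+ n))       ∎

  ι-+ : ∀ i j → ι (i ℤ.+ j) ≈ ι i + ι j
  ι-+ (+ m)    (+ n)    = ×-homo-+ 1# m n
  ι-+ (+ m)    -[1+ n ] = ι-⊖ m (ℕ.suc n)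
  ι-+ -[1+ m ] (+ n)    = trans (ι-⊖ n (ℕ.suc m)) (+-comm _ _)
  ι-+ -[1+ m ] -[1+ n ] = begin
    - (1# + ι (+ ℕ.suc (m ℕ.+ n)))      ≈⟨ -‿cong (+-congˡ (×-homo-+ 1# (ℕ.suc m) n)) ⟩
    - (1# + (ι (+ ℕ.suc m) + ι (+ n)))  ≈⟨ -‿cong (+-assoc _ _ _) ⟨
    - (1# + ι (+ ℕ.suc m) + ι (+ n))    ≈⟨ -‿cong (+-congʳ (+-comm _ _)) ⟩
    - (ι (+ ℕ.suc m) + 1# + ι (+ n))    ≈⟨ -‿cong (+-assoc _ _ _) ⟩
    - (ι (+ ℕ.suc m) + ι (+ ℕ.suc n))   ≈⟨ -‿+-comm _ _ ⟨
    - ι (+ ℕ.suc m) - ι (+ ℕ.suc n)     ∎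

  ι-neg : ∀ i → ι (ℤ.- i) ≈ - ι i
  ι-neg (+ ℕ.zero)    = sym -0#≈0#
  ι-neg (+ (ℕ.suc _)) = refl
  ι-neg -[1+ _ ]      = sym (-‿involutive _)

  ι-+* : ∀ m j → ι (+ m ℤ.* j) ≈ ι (+ m) * ι j
  ι-+* ℕ.zero j = trans (reflexive (≡.cong ι (ℤₚ.*-zeroˡ j))) (sym (zeroˡ _))
  ι-+* (ℕ.suc m) j = begin
    ι (+ ℕ.suc m ℤ.* j)      ≡⟨ ≡.cong ι (ℤₚ.suc-* (+ m) j) ⟩
    ι (j ℤ.+ + m ℤ.* j)      ≈⟨ ι-+ j (+ m ℤ.* j) ⟩
    ι j + ι (+ m ℤ.* j)      ≈⟨ +-cong (sym (*-identityˡ _)) (ι-+* m j) ⟩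
    1# * ι j + ι (+ m) * ι j ≈⟨ distribʳ _ _ _ ⟨
    (1# + ι (+ m)) * ι j     ∎

  ι-* : ∀ i j → ι (i ℤ.* j) ≈ ι i * ι j
  ι-* (+ m)    j = ι-+* m j
  ι-* -[1+ m ] j = begin
    ι (-[1+ m ] ℤ.* j)          ≡⟨ ≡.cong ι (ℤₚ.neg-distribˡ-* (+ ℕ.suc m) j) ⟨
    ι (ℤ.- (+ ℕ.suc m ℤ.* j))   ≈⟨ ι-neg (+ ℕ.suc m ℤ.* j) ⟩
    - ι (+ ℕ.suc m ℤ.* j)       ≈⟨ -‿cong (ι-+* (ℕ.suc m) j) ⟩
    - (ι (+ ℕ.suc m) * ι j)     ≈⟨ -‿distribˡ-* _ _ ⟩
    - ι (+ ℕ.suc m) * ι j       ∎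

  ι-1 : ι 1ℤ ≈ 1#
  ι-1 = ×-homo-1 1#

  -- A copy of ι that sends 1ℤ to 1# on the nose, so that the solver's constant
  -- con 1ℤ denotes 1#.
  coefficient : ℤ → ℝ
  coefficient (+ 1) = 1#
  coefficient i     = ι i

  coefficient≈ι : ∀ i → coefficient i ≈ ι i
  coefficient≈ι (+ 0)                 = refl
  coefficient≈ι (+ 1)                 = sym ι-1
  coefficient≈ι (+ (ℕ.suc (ℕ.suc _))) = refl
  coefficient≈ι -[1+ _ ]              = refl

  private
    coefficients : ℤ.+-*-rawRing -Raw-AlmostCommutative⟶ fromCommutativeRing commutativeRing
    coefficients = record
      { ⟦_⟧    = coefficient
      ; +-homo = λ i j → trans (coefficient≈ι (i ℤ.+ j)) (trans (ι-+ i j)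
                   (sym (+-cong (coefficient≈ι i) (coefficient≈ι j))))
      ; *-homo = λ i j → trans (coefficient≈ι (i ℤ.* j)) (trans (ι-* i j)
                   (sym (*-cong (coefficient≈ι i) (coefficient≈ι j))))
      ; -‿homo = λ i → trans (coefficient≈ι (ℤ.- i)) (trans (ι-neg i)
                   (sym (-‿cong (coefficient≈ι i))))
      ; 0-homo = refl
      ; 1-homo = refl
      }

    coefficient≟ : WeaklyDecidable (Induced-equivalence coefficients)
    coefficient≟ i j with i ℤₚ.≟ j
    ... | yes ≡.refl = just refl
    ... | no _       = nothing

  module Solver = RingSolver ℤ.+-*-rawRing (fromCommutativeRing commutativeRing)
                             coefficients coefficient≟
  open Solver using (solve; _:=_; _:+_; _:*_; _:-_; con)

  :1 :0 : ∀ {n} → Solver.Polynomial n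
  :1 = con 1ℤ
  :0 = con 0ℤ

  +-mono-≤ : ∀ {a b c d} → a ≤ b → c ≤ d → a + c ≤ b + d
  +-mono-≤ {a} {b} {c} {d} a≤b c≤d = ≤-trans (+-monoˡ-≤ c a≤b)
    (≤-trans (≤-reflexive (+-comm b c)) (≤-trans (+-monoˡ-≤ b c≤d) (≤-reflexive (+-comm d b))))

  ≤-via-difference : ∀ {a b c d} → a ≤ b → b - a ≈ d - c → c ≤ d
  ≤-via-difference {a} {b} {c} {d} a≤b eq = ≤-trans
    (≤-reflexive (solve 2 (λ a c → c := a :+ (c :- a)) refl a c))
    (≤-trans (+-monoˡ-≤ (c - a) a≤b)
    (≤-reflexive (trans (solve 3 (λ a b c → b :+ (c :- a) := b :- a :+ c) refl a b c)
                 (trans (+-congʳ eq) (solve 2 (λ c d → d :- c :+ c := d) refl c d)))))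

  0≤-difference : ∀ {a b} → a ≤ b → 0# ≤ b - a
  0≤-difference {a} {b} a≤b = ≤-via-difference a≤b (solve 2 (λ a b → b :- a := b :- a :- :0) refl a b)

  *-monoˡ-≤ : ∀ {t a b} → 0# ≤ t → a ≤ b → t * a ≤ t * b
  *-monoˡ-≤ {t} {a} {b} 0≤t a≤b = ≤-via-difference (*-nonNeg 0≤t (0≤-difference a≤b))
    (solve 3 (λ t a b → t :* (b :- a) :- :0 := t :* b :- t :* a) refl t a b)

  0≤1 : 0# ≤ 1#
  0≤1 with ≤-total 0# 1#
  ... | inj₁ 0≤1 = 0≤1
  ... | inj₂ 1≤0 = ≤-trans (*-nonNeg 0≤-1 0≤-1) (≤-reflexive (solve 0 ((:0 :- :1) :* (:0 :- :1) := :1) refl))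
    where
    0≤-1 = 0≤-difference 1≤0

  1≰0 : ¬ 1# ≤ 0#
  1≰0 1≤0 = 1≉0 (≤-antisym 1≤0 0≤1)

  ι-nonNeg : ∀ m → 0# ≤ ι (+ m)
  ι-nonNeg ℕ.zero    = ≤-refl
  ι-nonNeg (ℕ.suc m) = ≤-trans (≤-reflexive (sym (+-identityˡ 0#))) (+-mono-≤ 0≤1 (ι-nonNeg m))

  ι-difference : ∀ i j → ι (i ℤ.- j) ≈ ι i - ι j
  ι-difference i j = trans (ι-+ i (ℤ.- j)) (+-congˡ (ι-neg j))

  ι-mono-≤ : ∀ {i j} → i ℤ.≤ j → ι i ≤ ι j
  ι-mono-≤ {i} {j} i≤j with j ℤ.- i in eq | ℤₚ.i≤j⇒0≤j-i i≤j
  ... | + m | _ = ≤-via-difference (ι-nonNeg m) (begin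
    ι (+ m) - 0#    ≈⟨ solve 1 (λ m → m :- :0 := m) refl _ ⟩
    ι (+ m)         ≡⟨ ≡.cong ι eq ⟨
    ι (j ℤ.- i)     ≈⟨ ι-difference j i ⟩
    ι j - ι i       ∎)

  -- If `j < i`, then `ι (ℤ.suc j) ≤ ι i ≤ ι j`, which forces `1# ≤ 0#`. This brings inequalities
  -- obtained over the reals back to the integers.
  ι-cancel-≤ : ∀ {i j} → ι i ≤ ι j → i ℤ.≤ j
  ι-cancel-≤ {i} {j} ιi≤ιj with i ℤₚ.≤? j
  ... | yes i≤j = i≤j
  ... | no  i≰j = contradiction (≤-via-difference
          (≤-trans (ι-mono-≤ (ℤₚ.i<j⇒suc[i]≤j (ℤₚ.≰⇒> i≰j))) ιi≤ιj) (begin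
    ι j - ι (ℤ.suc j)   ≈⟨ +-congˡ (-‿cong (ι-+ 1ℤ j)) ⟩
    ι j - (ι 1ℤ + ι j)  ≈⟨ +-congˡ (-‿cong (+-congʳ ι-1)) ⟩
    ι j - (1# + ι j)    ≈⟨ solve 1 (λ j → j :- (:1 :+ j) := :0 :- :1) refl (ι j) ⟩
    0# - 1#             ∎)) 1≰0

  -- An upper bound s of the natural numbers makes s - 1 one as well.
  ι-unbounded : ∀ {M} → ¬ (∀ m → ι (+ m) ≤ M)
  ι-unbounded {M} ι≤M with supremum (λ x → ∃[ m ] x ≈ ι (+ m)) (0# , 0 , refl)
                                    (M , λ (m , x≈m) → ≤-trans (≤-reflexive x≈m) (ι≤M m))
  ... | s , ≤s , s-least = 1≰0 (≤-via-difference
    (s-least {s - 1#} λ (m , x≈m) → ≤-trans (≤-reflexive x≈m)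
      (≤-via-difference (≤s (ℕ.suc m , refl))
        (solve 2 (λ m s → s :- (:1 :+ m) := s :- :1 :- m) refl (ι (+ m)) s)))
    (solve 1 (λ s → s :- :1 :- s := :0 :- :1) refl s))

  *-cancel-0 : ∀ {t x} → 0# < t → t * x ≈ 0# → x ≈ 0#
  *-cancel-0 {t} {x} (_ , 0≉t) tx≈0 with inverse t (0≉t ∘ sym)
  ... | t⁻¹ , tt⁻¹≈1 = begin
    x             ≈⟨ *-identityˡ x ⟨
    1# * x        ≈⟨ *-congʳ tt⁻¹≈1 ⟨
    t * t⁻¹ * x   ≈⟨ solve 3 (λ t u x → t :* u :* x := u :* (t :* x)) refl t t⁻¹ x ⟩
    t⁻¹ * (t * x) ≈⟨ *-congˡ tx≈0 ⟩
    t⁻¹ * 0#      ≈⟨ zeroʳ t⁻¹ ⟩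
    0#            ∎

  <⇒≱ : ∀ {a b} → a < b → ¬ b ≤ a
  <⇒≱ (a≤b , a≉b) b≤a = a≉b (≤-antisym a≤b b≤a)

-- Integral and extreme solutions from a real solution

module RealSolutions (R : RealNumbers) where

  open RealNumbers R hiding (zero)
  open IntegralConvexity R
  open RealFacts R
  open Solver using (solve; _:=_; _:+_; _:*_; _:-_; :-_)
  open SetoidReasoning setoid

  infixl 7 _∙_
  _∙_ : ℝ^ n → Vec Trit n → ℝ
  p ∙ y = ⟨ p , (λ i → ι (toℤ (lookup y i))) ⟩

  ι-· : ∀ (z : ℤ^ n) y → ι^ z ∙ y ≈ ι (z · y)
  ι-· []      []      = refl
  ι-· (k ∷ z) (s ∷ y) = begin
    ι k * ι (toℤ s) + ι^ z ∙ y      ≈⟨ +-cong (ι-* k (toℤ s)) (sym (ι-· z y)) ⟨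
    ι (k ℤ.* toℤ s) + ι (z · y)     ≈⟨ ι-+ (k ℤ.* toℤ s) (z · y) ⟨
    ι (k ℤ.* toℤ s ℤ.+ z · y)       ∎

  ∙-congʳ : ∀ {p q : ℝ^ n} → p ≋ q → ∀ y → p ∙ y ≈ q ∙ y
  ∙-congʳ {ℕ.zero}  p≋q []      = refl
  ∙-congʳ {ℕ.suc n} p≋q (s ∷ y) = +-cong (*-congʳ (p≋q zero)) (∙-congʳ (p≋q ∘ suc) y)

  Bounds : Vector (ℤ ₋) n → Vector (ℤ ⁺) n → Pred (ℝ^ n) 0ℓ
  Bounds α β p = ∀ i → Maybe.map ι (α i) ≤₋ just (p i) × just (p i) ≤⁺ Maybe.map ι (β i)

  record RealSolution (S : System n) (α : Vector (ℤ ₋) n) (β : Vector (ℤ ⁺) n) (p : ℝ^ n) : Set where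
    constructor solves
    field
      rows   : ∀ {y v} → (y , v) ∈ˡ S → p ∙ y ≤ ι v
      bounds : Bounds α β p

  module _ {S : System n} {α : Vector (ℤ ₋) n} {β : Vector (ℤ ⁺) n} where

    fromIntegral : ∀ {z} → Solution S α β z → ι^ z ∈ RealSolution S α β
    fromIntegral {z} (solves rows bounds) = solves
      (λ {y} ∈S → ≤-trans (≤-reflexive (ι-· z y)) (ι-mono-≤ (rows ∈S)))
      (λ i → ≥α (proj₁ (bounds i)) , ≤β (proj₂ (bounds i)))
      where
      ≥α : ∀ {a k} → (∀ {l} → a ≡ just l → l ℤ.≤ k) → Maybe.map ι a ≤₋ just (ι k)
      ≥α {just _}  a≤k = IO.[ ι-mono-≤ (a≤k ≡.refl) ]
      ≥α {nothing} a≤k = IO.⊥₋≤ _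

      ≤β : ∀ {b k} → (∀ {l} → b ≡ just l → k ℤ.≤ l) → just (ι k) ≤⁺ Maybe.map ι b
      ≤β {just _}  k≤b = SO.[ ι-mono-≤ (k≤b ≡.refl) ]
      ≤β {nothing} k≤b = _ SO.≤⊤⁺

  leastValue-≤ : ∀ {a b s d x} → Maybe.map ι a ≤₋ just x → just x ≤⁺ Maybe.map ι b →
                 leastValue a b s ≡ just d → ι d ≤ x * ι (toℤ s)
  leastValue-≤ {s = 0ₜ} _ _ ≡.refl = ≤-reflexive (sym (zeroʳ _))
  leastValue-≤ {s = 1ₜ} {d} {x} IO.[ a≤x ] _ ≡.refl = ≤-via-difference a≤x
    -- The polynomial `:1 :+ :0` mirrors `1# + 0#`, the unfolding of `ι 1ℤ`.
    (solve 2 (λ x d → x :- d := x :* (:1 :+ :0) :- d) refl x (ι d))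
  leastValue-≤ {b = just b} {−1ₜ} {_} {x} _ SO.[ x≤b ] ≡.refl = ≤-via-difference x≤b (begin
    ι b - x                              ≈⟨ solve 2 (λ b x → b :- x := x :* (:- (:1 :+ :0)) :- (:- b)) refl (ι b) x ⟩
    x * - (1# + 0#) - - ι b              ≈⟨ +-congˡ (-‿cong (ι-neg b)) ⟨
    x * - (1# + 0#) - ι (ℤ.- b)          ∎)

  -- An eliminated row arises from a row of `S` by replacing the contribution of the first
  -- coordinate by its minimum over the box. That minimum is attained at an endpoint of the
  -- interval, so it bounds real values of the coordinate as well.
  eliminate-tail : ∀ {S : System (ℕ.suc n)} {α β p} → p ∈ RealSolution S α β →
                   Vector.tail p ∈ RealSolution (eliminate (Vector.head α) (Vector.head β) S)
                                                (Vector.tail α) (Vector.tail β)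
  eliminate-tail {S = S} {α} {β} {p} (solves rows bounds) = solves rows′ (bounds ∘ suc)
    where
    rows′ : ∀ {y w} → (y , w) ∈ˡ eliminate (Vector.head α) (Vector.head β) S → Vector.tail p ∙ y ≤ ι w
    rows′ {y} ∈H with s , v , d , ∈S , s↦d , ≡.refl ← ∈-eliminate⁻ S ∈H = ≤-via-difference
      (+-mono-≤ (rows ∈S) (leastValue-≤ {s = s} (proj₁ (bounds zero)) (proj₂ (bounds zero)) s↦d)) (begin
      ι v + ps - (ps + py + ι d)  ≈⟨ solve 4 (λ v d q r → v :+ q :- (q :+ r :+ d) := v :- d :- r) refl (ι v) (ι d) ps py ⟩
      ι v - ι d - py              ≈⟨ +-congʳ (ι-difference v d) ⟨
      ι (v ℤ.- d) - py            ∎)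
      where
      ps = p zero * ι (toℤ s)
      py = Vector.tail p ∙ y

  ConsistentBounds : Vector (ℤ ₋) n → Vector (ℤ ⁺) n → Set
  ConsistentBounds α β = ∀ i → Consistent (α i) (β i)

  -- The real solution is projected down to dimension 0, where each remaining row reads `0 ≤ v` and
  -- is thereby seen to hold. On the way back, every integral solution is extended by one coordinate
  -- in its fibre.
  integralSolution : ∀ {S : System n} {α β} → ConsistentBounds α β → MidpointConvex S →
                     Satisfiable (RealSolution S α β) → ∃[ z ] Solution S α β z
  integralSolution {ℕ.zero} _ _ (p , solves rows _) =
    [] , solves (λ { {[]} ∈S → ι-cancel-≤ (rows ∈S) }) (λ ())
  integralSolution {ℕ.suc n} {S} {α} {β} α≤β convex (p , p∈)
    with z , solution ← integralSolution (α≤β ∘ suc) (eliminate-midpointConvex (α≤β zero) convex)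
                                         (Vector.tail p , eliminate-tail {S = S} p∈)
    with z₁ , solution′ ← Fibre.extensible {α = α} {β} (α≤β zero) convex solution
    = z₁ ∷ z , solution′

  -- The second clause of `IsVertex`; membership is supplied separately by an integral `Solution`.
  Extreme : Pred (ℝ^ n) 0ℓ → ℝ^ n → Set
  Extreme P v = ∀ {p q t} → p ∈ P → q ∈ P → 0# < t → t < 1# → v ≋ mix t p q → p ≋ v × q ≋ v

  ≤-tight : ∀ {S : System (ℕ.suc n)} {α β z₁ z q} → Tight S (Vector.head β) z₁ z →
            q ∈ RealSolution S α β → Vector.tail q ≋ ι^ z → q zero ≤ ι z₁
  ≤-tight {β = β} {q = q} (inj₁ b≡z₁) (solves _ bounds) _ with β zero | proj₂ (bounds zero)
  ≤-tight (inj₁ ≡.refl) _ _ | just _ | SO.[ q≤b ] = q≤b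
  ≤-tight {z = z} {q} (inj₂ (y , v , ∈S , ≡.refl)) (solves rows _) q′≋z = ≤-via-difference (rows ∈S) (begin
    ι v - (q zero * (1# + 0#) + Vector.tail q ∙ y)  ≈⟨ +-congˡ (-‿cong (+-congˡ (trans (∙-congʳ q′≋z y) (ι-· z y)))) ⟩
    ι v - (q zero * (1# + 0#) + ι (z · y))          ≈⟨ solve 3 (λ v q r → v :- (q :* (:1 :+ :0) :+ r) := v :- r :- q) refl (ι v) (q zero) (ι (z · y)) ⟩
    ι v - ι (z · y) - q zero                        ≈⟨ +-congʳ (ι-difference v (z · y)) ⟨
    ι (v ℤ.- z · y) - q zero                        ∎)

  -- The gaps `c - a` and `c - b` are nonnegative, and their sum with the positive weights `t` and
  -- `1# - t` is 0, so both vanish.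
  mix-maximal : ∀ {t a b c} → 0# < t → t < 1# → a ≤ c → b ≤ c → c ≈ t * a + (1# - t) * b →
                a ≈ c × b ≈ c
  mix-maximal {t} {a} {b} {c} 0<t t<1 a≤c b≤c c≈ = a≈c , ≤-antisym b≤c (c≤b)
    where
    0≤t[c-a] = *-nonNeg (proj₁ 0<t) (0≤-difference a≤c)
    0≤1-t = 0≤-difference (proj₁ t<1)
    0≤[1-t][c-b] = *-nonNeg 0≤1-t (0≤-difference b≤c)
    0≈sum : t * (c - a) + (1# - t) * (c - b) ≈ 0#
    0≈sum = begin
      t * (c - a) + (1# - t) * (c - b)  ≈⟨ solve 4 (λ t a b c → t :* (c :- a) :+ (:1 :- t) :* (c :- b) := c :- (t :* a :+ (:1 :- t) :* b)) refl t a b c ⟩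
      c - (t * a + (1# - t) * b)        ≈⟨ +-congˡ (-‿cong c≈) ⟨
      c - c                             ≈⟨ -‿inverseʳ c ⟩
      0#                                ∎
    summand≈0 : ∀ {x y} → 0# ≤ x → 0# ≤ y → x + y ≈ 0# → x ≈ 0#
    summand≈0 {x} {y} 0≤x 0≤y x+y≈0 = ≤-antisym (≤-via-difference 0≤y (begin
      y - 0#          ≈⟨ solve 2 (λ x y → y :- :0 := x :+ y :- x) refl x y ⟩
      x + y - x       ≈⟨ +-congʳ x+y≈0 ⟩
      0# - x          ∎)) 0≤x
    difference≈0 : ∀ {x y} → x - y ≈ 0# → y ≈ x
    difference≈0 {x} {y} eq = begin
      y           ≈⟨ +-identityˡ y ⟨
      0# + y      ≈⟨ +-congʳ eq ⟨
      x - y + y   ≈⟨ solve 2 (λ x y → x :- y :+ y := x) refl x y ⟩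
      x           ∎
    0<1-t : 0# < 1# - t
    0<1-t = 0≤1-t , λ 0≈ → proj₂ t<1 (difference≈0 (sym 0≈))
    a≈c = difference≈0 (*-cancel-0 0<t (summand≈0 0≤t[c-a] 0≤[1-t][c-b] 0≈sum))
    b≈c = difference≈0 (*-cancel-0 0<1-t (summand≈0 0≤[1-t][c-b] 0≤t[c-a] (trans (+-comm _ _) 0≈sum)))
    c≤b = ≤-reflexive (sym b≈c)

  -- The vertex is the solution that is lexicographically largest when
  -- coordinates are compared from the last to the first.
  extremeSolution : ∀ {S : System n} {α β M} → ConsistentBounds α β → MidpointConvex S →
                    Satisfiable (RealSolution S α β) →
                    (∀ {z} → Solution S α β z → ∀ i → ι (lookup z i) ≤ M) →
                    ∃[ z ] Solution S α β z × Extreme (RealSolution S α β) (ι^ z)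
  extremeSolution {ℕ.zero} α≤β convex p _ =
    let z , solution = integralSolution α≤β convex p in z , solution , λ _ _ _ _ _ → (λ ()) , (λ ())
  extremeSolution {ℕ.suc n} {S} {α} {β} {M} α≤β convex (p , p∈) bounded
    with z , solution , extreme ← extremeSolution {M = M} (α≤β ∘ suc)
           (eliminate-midpointConvex (α≤β zero) convex)
           (Vector.tail p , eliminate-tail {S = S} p∈)
           -- Every solution of the eliminated system extends to one of `S`, and so inherits the
           -- bound `M`.
           (λ solution i → let _ , solution′ = Fibre.extensible {α = α} {β} (α≤β zero) convex solution
                           in bounded solution′ (suc i))
    with Fibre.largestExtension {α = α} {β} (α≤β zero) convex solution
  -- Here the first coordinate could exceed every natural number while staying below `M`.
  ... | inj₂ above = contradiction
          (λ m → let _ , m≤z₁ , solution′ = above (+ m) in ≤-trans (ι-mono-≤ m≤z₁) (bounded solution′ zero))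
          ι-unbounded
  ... | inj₁ (z₁ , solution′ , tight) = z₁ ∷ z , solution′ , extreme′
    where
    extreme′ : Extreme (RealSolution S α β) (ι^ (z₁ ∷ z))
    extreme′ {p} {q} {t} p∈ q∈ 0<t t<1 v≋ =
      (λ { zero → proj₁ first ; (suc i) → proj₁ rest i }) ,
      (λ { zero → proj₂ first ; (suc i) → proj₂ rest i })
      where
      rest = extreme {t = t} (eliminate-tail {S = S} p∈) (eliminate-tail {S = S} q∈) 0<t t<1 (v≋ ∘ suc)
      -- By induction the tails of `p` and `q` both equal `ι^ z`. Over this common tail the tight
      -- inequality caps their first coordinates at `ι z₁`, so neither can fall short of it.
      first = mix-maximal 0<t t<1 (≤-tight {S = S} {α} {β} {z₁} {z} tight p∈ (proj₁ rest))
                                  (≤-tight {S = S} {α} {β} {z₁} {z} tight q∈ (proj₂ rest)) (v≋ zero)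

lookup-injective : ∀ {A : Set} {n} {xs ys : Vec A n} → (∀ i → lookup xs i ≡ lookup ys i) → xs ≡ ys
lookup-injective {xs = xs} {ys} eq = ≡.trans (≡.sym (tabulate∘lookup xs))
  (≡.trans (tabulate-cong eq) (tabulate∘lookup ys))

-- Affine minorants and the local convex extension

module LocalConvexity (R : RealNumbers) where

  open RealNumbers R hiding (zero)
  open IntegralConvexity R
  open RealFacts R
  open Solver using (solve; _:=_; _:+_; _:*_; _:-_; :-_)
  open SetoidReasoning setoid
  open Sums semiring using (sum-cong-≋; ∑-comm; ∑-distrib-+; *-distribˡ-sum; *-distribʳ-sum)
  open Max totalOrder using (x≤x⊔y; x≤y⊔x; ⊔-sel)

  ⟨,⟩-mix : ∀ t (p x y : ℝ^ n) → ⟨ p , mix t x y ⟩ ≈ t * ⟨ p , x ⟩ + (1# - t) * ⟨ p , y ⟩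
  ⟨,⟩-mix {ℕ.zero}  t p x y = solve 1 (λ t → :0 := t :* :0 :+ (:1 :- t) :* :0) refl t
  ⟨,⟩-mix {ℕ.suc n} t p x y = trans (+-congˡ (⟨,⟩-mix t (Vector.tail p) (Vector.tail x) (Vector.tail y)))
    (solve 6 (λ t p x y px py → p :* (t :* x :+ (:1 :- t) :* y) :+ (t :* px :+ (:1 :- t) :* py)
                            := t :* (p :* x :+ px) :+ (:1 :- t) :* (p :* y :+ py)) refl t _ _ _ _ _)

  ⟨,⟩-⊖ : ∀ (p x y : ℝ^ n) → ⟨ p , x ⊖ y ⟩ ≈ ⟨ p , x ⟩ - ⟨ p , y ⟩
  ⟨,⟩-⊖ {ℕ.zero}  p x y = solve 0 (:0 := :0 :- :0) refl
  ⟨,⟩-⊖ {ℕ.suc n} p x y = trans (+-congˡ (⟨,⟩-⊖ (Vector.tail p) (Vector.tail x) (Vector.tail y)))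
    (solve 5 (λ p x y px py → p :* (x :- y) :+ (px :- py) := p :* x :+ px :- (p :* y :+ py)) refl _ _ _ _ _)

  +⁺-mono : ∀ {a b x y} → just a ≤⁺ x → just b ≤⁺ y → just (a + b) ≤⁺ x +⁺ y
  +⁺-mono SO.[ a≤x ]   SO.[ b≤y ]   = SO.[ +-mono-≤ a≤x b≤y ]
  +⁺-mono SO.[ a≤x ]   (_ SO.≤⊤⁺)   = _ SO.≤⊤⁺
  +⁺-mono (_ SO.≤⊤⁺)   _            = _ SO.≤⊤⁺

  ·⁺-mono : ∀ {t a x} → 0# ≤ t → just a ≤⁺ x → just (t * a) ≤⁺ t ·⁺ x
  ·⁺-mono         0≤t SO.[ a≤x ] = SO.[ *-monoˡ-≤ 0≤t a≤x ]
  ·⁺-mono {t} {a} 0≤t (_ SO.≤⊤⁺) with t ≟ 0#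
  -- By the convention for the scalar 0 the right-hand side is 0 here, not infinite.
  ... | yes t≈0 = SO.[ ≤-reflexive (trans (*-congʳ t≈0) (zeroˡ a)) ]
  ... | no  _   = _ SO.≤⊤⁺

  sum⁺-mono : ∀ {k} {w a : Vector ℝ k} (g : Vector (ℝ ⁺) k) → (∀ j → 0# ≤ w j) → (∀ j → just (a j) ≤⁺ g j) →
              just (∑[ j < k ] (w j * a j)) ≤⁺ sum⁺ (λ j → w j ·⁺ g j)
  sum⁺-mono {ℕ.zero}  g 0≤w a≤g = SO.[ ≤-refl ]
  sum⁺-mono {ℕ.suc k} g 0≤w a≤g = +⁺-mono (·⁺-mono (0≤w zero) (a≤g zero))
    (sum⁺-mono (Vector.tail g) (0≤w ∘ suc) (a≤g ∘ suc))

  ≤⁺-respʳ : ∀ {a u v} → just a ≤⁺ v → u ≈⁺ v → just a ≤⁺ u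
  ≤⁺-respʳ SO.[ a≤v ] SE.[ u≈v ]   = SO.[ ≤-trans a≤v (≤-reflexive (sym u≈v)) ]
  ≤⁺-respʳ _          SE.⊤⁺≈⊤⁺     = _ SO.≤⊤⁺

  module _ {x : ℝ^ n} (c : ConvexCombination x) where
    open ConvexCombination c

    -- Exchanging the two summations reduces the linear part to the barycentre equations; the
    -- constant part survives because the weights sum to 1.
    affineValue : ∀ p d → ∑[ j < size ] (weight j * (⟨ p , ι^ (point j) ⟩ + d)) ≈ ⟨ p , x ⟩ + d
    affineValue p d = begin
      ∑[ j < size ] (weight j * (⟨ p , ι^ (point j) ⟩ + d))
        ≈⟨ sum-cong-≋ (λ j → distribˡ (weight j) _ d) ⟩
      ∑[ j < size ] (weight j * ⟨ p , ι^ (point j) ⟩ + weight j * d)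
        ≈⟨ ∑-distrib-+ (λ j → weight j * ⟨ p , ι^ (point j) ⟩) (λ j → weight j * d) ⟩
      ∑[ j < size ] (weight j * ⟨ p , ι^ (point j) ⟩) + ∑[ j < size ] (weight j * d)
        ≈⟨ +-cong linear (trans (sym (*-distribʳ-sum d weight)) (trans (*-congʳ total) (*-identityˡ d))) ⟩
      ⟨ p , x ⟩ + d ∎
      where
      linear : ∑[ j < size ] (weight j * ⟨ p , ι^ (point j) ⟩) ≈ ⟨ p , x ⟩
      linear = begin
        ∑[ j < size ] (weight j * ⟨ p , ι^ (point j) ⟩)
          ≈⟨ sum-cong-≋ (λ j → *-distribˡ-sum (weight j) (λ i → p i * ι^ (point j) i)) ⟩
        ∑[ j < size ] ∑[ i < n ] (weight j * (p i * ι^ (point j) i))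
          ≈⟨ ∑-comm (λ j i → weight j * (p i * ι^ (point j) i)) ⟩
        ∑[ i < n ] ∑[ j < size ] (weight j * (p i * ι^ (point j) i))
          ≈⟨ sum-cong-≋ (λ i → sum-cong-≋ (λ j →
               solve 3 (λ w p z → w :* (p :* z) := p :* (w :* z)) refl (weight j) (p i) (ι^ (point j) i))) ⟩
        ∑[ i < n ] ∑[ j < size ] (p i * (weight j * ι^ (point j) i))
          ≈⟨ sum-cong-≋ (λ i → *-distribˡ-sum (p i) (λ j → weight j * ι^ (point j) i)) ⟨
        ∑[ i < n ] (p i * ∑[ j < size ] (weight j * ι^ (point j) i))
          ≈⟨ sum-cong-≋ (λ i → *-congˡ (barycentre i)) ⟩
        ⟨ p , x ⟩ ∎

    -- Weak duality for the linear program that defines the extension at `x`: the minorant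
    -- inequalities are weighted and summed.
    minorant-value : ∀ {f} p d → (∀ z → z ∈ N x → just (⟨ p , ι^ z ⟩ + d) ≤⁺ f z) →
                     just (⟨ p , x ⟩ + d) ≤⁺ value f
    minorant-value {f} p d minorant = ≤⁺-resp-≈ (affineValue p d) 
      (sum⁺-mono (f ∘ point) nonNeg (λ j → minorant (point j) (sound j)))
      where
      ≤⁺-resp-≈ : ∀ {a b v} → a ≈ b → just a ≤⁺ v → just b ≤⁺ v
      ≤⁺-resp-≈ a≈b SO.[ a≤v ] = SO.[ ≤-trans (≤-reflexive (sym a≈b)) a≤v ]
      ≤⁺-resp-≈ a≈b (_ SO.≤⊤⁺) = _ SO.≤⊤⁺

  -- With `M` equal to k + 1 and `t` its inverse, `mix t u v` is (u + k v) / (k + 1). The value k =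
  -- 1 gives midpoints and large k gives points close to `v`; multiplying by `M` turns conditions on
  -- neighbourhoods into conditions on integers.
  module Scale (k : ℕ) where

    M : ℝ
    M = ι (+ ℕ.suc k)

    1≤M : 1# ≤ M
    1≤M = ≤-trans (≤-reflexive (sym (+-identityʳ 1#))) (+-mono-≤ ≤-refl (ι-nonNeg k))

    private
      inverseOfM : ∃[ t ] M * t ≈ 1#
      inverseOfM = inverse M λ M≈0 → 1≰0 (≤-trans 1≤M (≤-reflexive M≈0))

    t : ℝ
    t = proj₁ inverseOfM

    Mt≈1 : M * t ≈ 1#
    Mt≈1 = proj₂ inverseOfM

    0≤t : 0# ≤ t
    0≤t with ≤-total 0# t
    ... | inj₁ 0≤t = 0≤t
    ... | inj₂ t≤0 = contradiction (≤-trans (≤-reflexive (sym Mt≈1))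
            (≤-trans (*-monoˡ-≤ (ι-nonNeg (ℕ.suc k)) t≤0) (≤-reflexive (zeroʳ M)))) 1≰0

    t≤1 : t ≤ 1#
    t≤1 = ≤-trans (≤-reflexive (sym (*-identityʳ t)))
         (≤-trans (*-monoˡ-≤ 0≤t 1≤M) (≤-reflexive (trans (*-comm t M) Mt≈1)))

    tM* : ∀ x → t * (M * x) ≈ x
    tM* x = begin
      t * (M * x) ≈⟨ solve 3 (λ t m x → t :* (m :* x) := m :* t :* x) refl t M x ⟩
      M * t * x   ≈⟨ *-congʳ Mt≈1 ⟩
      1# * x      ≈⟨ *-identityˡ x ⟩
      x           ∎

    M*-cancel-≤ : ∀ {x} → M ≤ M * x → 1# ≤ x
    M*-cancel-≤ {x} M≤Mx = ≤-trans (≤-reflexive (trans (sym Mt≈1) (*-comm M t)))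
      (≤-trans (*-monoˡ-≤ 0≤t M≤Mx) (≤-reflexive (tM* x)))

    -- If the absolute value of `e` were at least k + 1, cancelling `M` would show `1# ≤ q` or
    -- `1# ≤ - q`, according to the sign of `e`.
    ∣∣<1⇒∣∣<suc : ∀ {q} e → ∣ q ∣ < 1# → M * q ≈ ι e → ℤ.∣ e ∣ ℕ.< ℕ.suc k
    ∣∣<1⇒∣∣<suc {q} e ∣q∣<1 Mq≈e with ℕ.suc k ℕₚ.≤? ℤ.∣ e ∣
    ... | no  k≮∣e∣ = ℕₚ.≰⇒> k≮∣e∣
    ... | yes k<∣e∣ = contradiction (1≤∣q∣ e k<∣e∣ Mq≈e) (<⇒≱ ∣q∣<1)
      where
      1≤∣q∣ : ∀ e → ℕ.suc k ℕ.≤ ℤ.∣ e ∣ → M * q ≈ ι e → 1# ≤ ∣ q ∣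
      1≤∣q∣ (+ j) k<j Mq≈e = ≤-trans (M*-cancel-≤ (≤-trans (ι-mono-≤ (ℤ.+≤+ k<j)) (≤-reflexive (sym Mq≈e))))
        (x≤x⊔y q (- q))
      1≤∣q∣ -[1+ j ] k<j Mq≈e = ≤-trans (M*-cancel-≤ (≤-trans (ι-mono-≤ (ℤ.+≤+ k<j)) (≤-reflexive (begin
        ι (+ ℕ.suc j)         ≈⟨ ι-neg -[1+ j ] ⟩
        - ι -[1+ j ]          ≈⟨ -‿cong Mq≈e ⟨
        - (M * q)             ≈⟨ solve 2 (λ m q → :- (m :* q) := m :* (:- q)) refl M q ⟩
        M * - q               ∎)))) (x≤y⊔x q (- q))

    M*mix : ∀ a b → M * (t * a + (1# - t) * b) ≈ a + ι (+ k) * b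
    M*mix a b = begin
      M * (t * a + (1# - t) * b)
        ≈⟨ solve 4 (λ m t a b → m :* (t :* a :+ (:1 :- t) :* b) := m :* t :* (a :- b) :+ m :* b) refl M t a b ⟩
      M * t * (a - b) + M * b         ≈⟨ +-congʳ (*-congʳ Mt≈1) ⟩
      1# * (a - b) + (1# + ι (+ k)) * b
        ≈⟨ solve 3 (λ k a b → :1 :* (a :- b) :+ (:1 :+ k) :* b := a :+ k :* b) refl (ι (+ k)) a b ⟩
      a + ι (+ k) * b                 ∎

    -- The neighbourhood of (u + k v) / (k + 1), with denominators cleared.
    Within : (u v z : ℤ^ n) → Set
    Within u v z = ∀ i → ℤ.∣ (lookup u i ℤ.- lookup v i) ℤ.+ + ℕ.suc k ℤ.* (lookup v i ℤ.- lookup z i) ∣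
                         ℕ.< ℕ.suc k

    N-mix : ∀ {u v z : ℤ^ n} → z ∈ N (mix t (ι^ u) (ι^ v)) → Within u v z
    N-mix {u = u} {v} {z} z∈N i = ∣∣<1⇒∣∣<suc
      ((uᵢ ℤ.- vᵢ) ℤ.+ + ℕ.suc k ℤ.* (vᵢ ℤ.- zᵢ)) (z∈N i) (begin
      M * (t * ι uᵢ + (1# - t) * ι vᵢ - ι zᵢ)
        ≈⟨ solve 3 (λ m x z → m :* (x :- z) := m :* x :- m :* z) refl M (t * ι uᵢ + (1# - t) * ι vᵢ) (ι zᵢ) ⟩
      M * (t * ι uᵢ + (1# - t) * ι vᵢ) - M * ι zᵢ
        ≈⟨ +-congʳ (M*mix (ι uᵢ) (ι vᵢ)) ⟩
      ι uᵢ + ι (+ k) * ι vᵢ - (1# + ι (+ k)) * ι zᵢ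
        ≈⟨ solve 4 (λ k u v z → u :+ k :* v :- (:1 :+ k) :* z := u :- v :+ (:1 :+ k) :* (v :- z)) refl (ι (+ k)) (ι uᵢ) (ι vᵢ) (ι zᵢ) ⟩
      ι uᵢ - ι vᵢ + M * (ι vᵢ - ι zᵢ)
        ≈⟨ +-cong (ι-difference uᵢ vᵢ) (trans (ι-* (+ ℕ.suc k) (vᵢ ℤ.- zᵢ)) (*-congˡ (ι-difference vᵢ zᵢ))) ⟨
      ι (uᵢ ℤ.- vᵢ) + ι (+ ℕ.suc k ℤ.* (vᵢ ℤ.- zᵢ))
        ≈⟨ ι-+ (uᵢ ℤ.- vᵢ) (+ ℕ.suc k ℤ.* (vᵢ ℤ.- zᵢ)) ⟨
      ι ((uᵢ ℤ.- vᵢ) ℤ.+ + ℕ.suc k ℤ.* (vᵢ ℤ.- zᵢ)) ∎)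
      where
      uᵢ = lookup u i
      vᵢ = lookup v i
      zᵢ = lookup z i

  -- At scale 0 the factor `M` is 1, and an integer of absolute value below 1 is 0.
  N-ι^ : ∀ {u z : ℤ^ n} → z ∈ N (ι^ u) → z ≡ u
  N-ι^ {u = u} {z} z∈N = lookup-injective λ i → ≡.sym (ℤₚ.i-j≡0⇒i≡j _ _
    (ℤₚ.∣i∣≡0⇒i≡0 (ℕₚ.n<1⇒n≡0 (Scale.∣∣<1⇒∣∣<suc 0 (lookup u i ℤ.- lookup z i) (z∈N i) (begin
      ι 1ℤ * (ι (lookup u i) - ι (lookup z i))  ≈⟨ *-congʳ ι-1 ⟩
      1# * (ι (lookup u i) - ι (lookup z i))    ≈⟨ *-identityˡ _ ⟩
      ι (lookup u i) - ι (lookup z i)           ≈⟨ ι-difference (lookup u i) (lookup z i) ⟨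
      ι (lookup u i ℤ.- lookup z i)             ∎)))))

  ι^∈N : ∀ (u : ℤ^ n) → u ∈ N (ι^ u)
  ι^∈N u i = ≤-trans (≤-reflexive ∣0∣≈0) 0≤1 , λ ∣0∣≈1 → 1≉0 (trans (sym ∣0∣≈1) ∣0∣≈0)
    where
    d = ι (lookup u i) - ι (lookup u i)
    ∣0∣≈0 : ∣ d ∣ ≈ 0#
    ∣0∣≈0 with ⊔-sel d (- d)
    ... | inj₁ eq = trans eq (-‿inverseʳ _)
    ... | inj₂ eq = trans eq (solve 1 (λ u → :- (u :- u) := :0) refl (ι (lookup u i)))

  pointMass : ∀ (u : ℤ^ n) → ConvexCombination (ι^ u)
  pointMass u = record
    { enumeration = record
      { size       = 1
      ; point      = λ _ → u
      ; injective  = λ { {zero} {zero} _ → ≡.refl }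
      ; sound      = λ _ → ι^∈N u
      ; surjective = λ {z} z∈N → zero , ≡.sym (N-ι^ {u = u} {z} z∈N)
      }
    ; weight     = λ _ → 1#
    ; barycentre = λ i → trans (+-identityʳ _) (*-identityˡ _)
    ; total      = +-identityʳ 1#
    ; nonNeg     = λ _ → 0≤1
    }

  module _ {f : ℤ^ n → ℝ ⁺} (integrallyConvex : IntegrallyConvex f) where

    private
      f̃           = proj₁ (proj₂ integrallyConvex)
      isExtension = proj₁ (proj₂ (proj₂ integrallyConvex))
      convex      = proj₂ (proj₂ (proj₂ integrallyConvex))

    -- The point mass at `u` competes in the minimum that defines `f̃ (ι^ u)`.
    extension-≤ : ∀ {u a} → f u ≡ just a → f̃ (ι^ u) ≤⁺ just a
    extension-≤ {u} {a} fu≡a = SO.≤⁺-trans _≤_ ≤-trans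
      (proj₂ (isExtension (ι^ u)) (pointMass u , SE.≈⁺-refl _≈_ refl))
      pointMass-≤
      where
      pointMass-≤ : ConvexCombination.value (pointMass u) f ≤⁺ just a
      pointMass-≤ rewrite fu≡a = SO.[ ≤-reflexive (trans (+-identityʳ _) (*-identityˡ a)) ]

    -- By weak duality the minorant lies below `f̃` at the mixed point; convexity bounds `f̃` there
    -- by its values at the two lattice points, and these are at most `a` and `b`. Convexity of `f̃`
    -- enters the proof only here.
    minorant-mix : ∀ {u v a b t} p d → f u ≡ just a → f v ≡ just b → 0# ≤ t → t ≤ 1# →
                   (∀ z → z ∈ N (mix t (ι^ u) (ι^ v)) → just (⟨ p , ι^ z ⟩ + d) ≤⁺ f z) →
                   ⟨ p , mix t (ι^ u) (ι^ v) ⟩ + d ≤ t * a + (1# - t) * b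
    minorant-mix {u} {v} {a} {b} {t} p d fu≡a fv≡b 0≤t t≤1 minorant
      with f̃ (ι^ u) | f̃ (ι^ v) | extension-≤ fu≡a | extension-≤ fv≡b | convex (ι^ u) (ι^ v) t 0≤t t≤1
    ... | just a′ | just b′ | SO.[ a′≤a ] | SO.[ b′≤b ] | f̃≤
      with c , f̃≈ ← proj₁ (isExtension (mix t (ι^ u) (ι^ v)))
      = ≤-trans (SO.[≤]-injective _≤_ (SO.≤⁺-trans _≤_ ≤-trans
          (≤⁺-respʳ (minorant-value c p d minorant) f̃≈) f̃≤))
        (+-mono-≤ (*-monoˡ-≤ 0≤t a′≤a) (*-monoˡ-≤ (0≤-difference t≤1) b′≤b))

    -- This is `minorant-mix` at t = 1 / (k + 1), multiplied by k + 1.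
    minorant-scaled : ∀ {u v a b} k p d → f u ≡ just a → f v ≡ just b →
                      (∀ z → Scale.Within k u v z → just (⟨ p , ι^ z ⟩ + d) ≤⁺ f z) →
                      (⟨ p , ι^ u ⟩ + d) + ι (+ k) * (⟨ p , ι^ v ⟩ + d) ≤ a + ι (+ k) * b
    minorant-scaled {u} {v} {a} {b} k p d fu≡a fv≡b minorant = ≤-via-difference
      (*-monoˡ-≤ (ι-nonNeg (ℕ.suc k))
        (minorant-mix {u} {v} p d fu≡a fv≡b 0≤t t≤1 λ z z∈N → minorant z (N-mix {u = u} {v} {z} z∈N)))
      (+-cong (M*mix a b) (-‿cong (begin
        M * (⟨ p , mix t (ι^ u) (ι^ v) ⟩ + d)
          ≈⟨ *-congˡ (+-congʳ (⟨,⟩-mix t p (ι^ u) (ι^ v))) ⟩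
        M * (t * pu + (1# - t) * pv + d)
          ≈⟨ *-congˡ (solve 4 (λ t x y d → t :* x :+ (:1 :- t) :* y :+ d := t :* (x :+ d) :+ (:1 :- t) :* (y :+ d)) refl t pu pv d) ⟩
        M * (t * (pu + d) + (1# - t) * (pv + d))
          ≈⟨ M*mix (pu + d) (pv + d) ⟩
        pu + d + ι (+ k) * (pv + d) ∎)))
      where
      open Scale k
      pu = ⟨ p , ι^ u ⟩
      pv = ⟨ p , ι^ v ⟩

-- The finite system of inequalities in directions with entries -1, 0, 1

allTrits : List Trit
allTrits = −1ₜ ∷ 0ₜ ∷ 1ₜ ∷ []

∈-allTrits : ∀ s → s ∈ˡ allTrits
∈-allTrits −1ₜ = here ≡.refl
∈-allTrits 0ₜ  = there (here ≡.refl)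
∈-allTrits 1ₜ  = there (there (here ≡.refl))

allDirections : ∀ n → List (Vec Trit n)
allDirections ℕ.zero    = [] ∷ []
allDirections (ℕ.suc n) = cartesianProductWith _∷_ allTrits (allDirections n)

∈-allDirections : (y : Vec Trit n) → y ∈ˡ allDirections n
∈-allDirections []      = here ≡.refl
∈-allDirections (s ∷ y) = ∈-cartesianProductWith⁺ _∷_ (∈-allTrits s) (∈-allDirections y)

infixl 6 _+ᵗ_
_+ᵗ_ : ℤ^ n → Vec Trit n → ℤ^ n
x +ᵗ y = zipWith (λ k s → k ℤ.+ toℤ s) x y

negatedTrit : ∀ i → ℤ.∣ i ∣ ℕ.< 2 → ∃[ s ] toℤ s ≡ ℤ.- i
negatedTrit (+ 0)    _ = 0ₜ , ≡.refl
negatedTrit (+ 1)    _ = −1ₜ , ≡.refl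
negatedTrit -[1+ 0 ] _ = 1ₜ , ≡.refl
negatedTrit (+ (ℕ.suc (ℕ.suc _))) (s≤s (s≤s ()))
negatedTrit -[1+ ℕ.suc _ ]        (s≤s (s≤s ()))

neighbour : ∀ (x z : ℤ^ n) → (∀ i → ℤ.∣ lookup x i ℤ.- lookup z i ∣ ℕ.< 2) → ∃[ y ] z ≡ x +ᵗ y
neighbour []      []      _     = [] , ≡.refl
neighbour (k ∷ x) (l ∷ z) close
  with s , s≡l-k ← negatedTrit (k ℤ.- l) (close zero) | y , z≡x+y ← neighbour x z (close ∘ suc)
  = s ∷ y , ≡.cong₂ _∷_ (≡.trans (rearrange k l) (≡.cong (λ i → k ℤ.+ i) (≡.sym s≡l-k))) z≡x+y
  where
  rearrange : ∀ k l → l ≡ k ℤ.+ ℤ.- (k ℤ.- l)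
  rearrange = solve-∀

-- The triangle inequality gives m|w| ≤ |e + m w| + |e| < 2m. With `w` a coordinate of `x` minus a
-- lattice neighbour of the mixed point, it shows that this neighbour is `x +ᵗ y` for some direction
-- `y`.
∣e+mw∣<m⇒∣w∣<2 : ∀ k e w → ℤ.∣ e ∣ ℕ.≤ ℕ.suc k → ℤ.∣ e ℤ.+ + ℕ.suc k ℤ.* w ∣ ℕ.< ℕ.suc k → ℤ.∣ w ∣ ℕ.< 2
∣e+mw∣<m⇒∣w∣<2 k e w ∣e∣≤m ∣e+mw∣<m = ℕₚ.*-cancelˡ-< m ℤ.∣ w ∣ 2 (begin-strict
  m ℕ.* ℤ.∣ w ∣                               ≡⟨ ℤₚ.abs-* (+ m) w ⟨
  ℤ.∣ + m ℤ.* w ∣                             ≡⟨ ≡.cong ℤ.∣_∣ (eq e (+ m ℤ.* w)) ⟩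
  ℤ.∣ e ℤ.+ + m ℤ.* w ℤ.- e ∣                 ≤⟨ ℤₚ.∣i-j∣≤∣i∣+∣j∣ (e ℤ.+ + m ℤ.* w) e ⟩
  ℤ.∣ e ℤ.+ + m ℤ.* w ∣ ℕ.+ ℤ.∣ e ∣           <⟨ ℕₚ.+-mono-<-≤ ∣e+mw∣<m ∣e∣≤m ⟩
  m ℕ.+ m                                     ≡⟨ ≡.cong (m ℕ.+_) (ℕₚ.+-identityʳ m) ⟨
  2 ℕ.* m                                     ≡⟨ ℕₚ.*-comm 2 m ⟩
  m ℕ.* 2                                     ∎)
  where
  m = ℕ.suc k
  open ℕₚ.≤-Reasoning
  eq : ∀ e q → q ≡ e ℤ.+ q ℤ.- e
  eq = solve-∀

∣toℤ∣≤1 : ∀ s → ℤ.∣ toℤ s ∣ ℕ.≤ 1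
∣toℤ∣≤1 −1ₜ = ℕₚ.≤-refl
∣toℤ∣≤1 0ₜ  = z≤n
∣toℤ∣≤1 1ₜ  = ℕₚ.≤-refl

upperBound : (g : Fin n → ℕ) → ∃[ m ] (∀ i → g i ℕ.≤ m)
upperBound {ℕ.zero}  g = 0 , λ ()
upperBound {ℕ.suc n} g = let m , g≤m = upperBound (g ∘ suc) in
  g zero ℕ.⊔ m , λ { zero → ℕₚ.m≤m⊔n _ _ ; (suc i) → ℕₚ.≤-trans (g≤m i) (ℕₚ.m≤n⊔m _ _) }

module LocalSystem (f : ℤ^ n → ℤ ⁺) (x : ℤ^ n) (fx : ℤ) where

  localRow : Vec Trit n → Maybe (Row n)
  localRow y = Maybe.map (λ w → y , w ℤ.- fx) (f (x +ᵗ y))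

  localSystem : System n
  localSystem = mapMaybe localRow (allDirections n)

  ∈-localSystem⁺ : ∀ {y w} → f (x +ᵗ y) ≡ just w → (y , w ℤ.- fx) ∈ˡ localSystem
  ∈-localSystem⁺ {y} eq = ∈-mapMaybe⁺ (∈-allDirections y) (≡.cong (Maybe.map λ w → y , w ℤ.- fx) eq)

  ∈-localSystem⁻ : ∀ {y v} → (y , v) ∈ˡ localSystem → ∃[ w ] f (x +ᵗ y) ≡ just w × v ≡ w ℤ.- fx
  ∈-localSystem⁻ ∈S with ∈-mapMaybe⁻ (allDirections n) ∈S
  ... | y , _ , eq with f (x +ᵗ y) in eq′ | eq
  ...   | just w | ≡.refl = w , eq′ , ≡.refl

-- The local system describes the subdifferential

module Subdifferential (R : RealNumbers) where

  open RealNumbers R hiding (zero)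
  open IntegralConvexity R
  open RealFacts R
  open RealSolutions R
  open LocalConvexity R
  open Solver using (solve; _:=_; _:+_; _:*_; _:-_; :-_)
  open SetoidReasoning setoid
  open Max totalOrder using (x≤x⊔y)
  open Sums semiring using (sum-cong-≋)

  ⟨,⟩-+ᵗ : ∀ (p : ℝ^ n) x y → ⟨ p , ι^ (x +ᵗ y) ⟩ ≈ ⟨ p , ι^ x ⟩ + p ∙ y
  ⟨,⟩-+ᵗ p []      []      = sym (+-identityʳ 0#)
  ⟨,⟩-+ᵗ p (k ∷ x) (s ∷ y) = trans
    (+-cong (*-congˡ (ι-+ k (toℤ s))) (⟨,⟩-+ᵗ (Vector.tail p) x y))
    (solve 5 (λ p k s px py → p :* (k :+ s) :+ (px :+ py) := p :* k :+ px :+ (p :* s :+ py)) refl _ _ _ _ _)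

  module _ (f : ℤ^ n → ℤ ⁺) (convex : IntegrallyConvex (toReal f)) (x : ℤ^ n) {fx : ℤ} where
    open LocalSystem f x fx

    -- A minorant of the rows near (a + b) / 2 becomes, after translation by `x` and `fx`, an affine
    -- minorant of `f` near the midpoint of `x +ᵗ a` and `x +ᵗ b`. The scale k = 1 of
    -- `minorant-scaled` applies to it.
    localSystem-midpointConvex : MidpointConvex localSystem
    localSystem-midpointConvex {a} {_} {b} ∈S ∈S′ p c minorant
      with u , fa≡u , ≡.refl ← ∈-localSystem⁻ ∈S
      with v , fb≡v , ≡.refl ← ∈-localSystem⁻ ∈S′
      = ι-cancel-≤ (≤-via-difference
          (minorant-scaled convex {x +ᵗ a} {x +ᵗ b} 1 (ι^ p) d (≡.cong (Maybe.map ι) fa≡u)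
                           (≡.cong (Maybe.map ι) fb≡v) realMinorant)
          (begin
            ι u + ι 1ℤ * ι v - (⟨ ι^ p , ι^ (x +ᵗ a) ⟩ + d + ι 1ℤ * (⟨ ι^ p , ι^ (x +ᵗ b) ⟩ + d))
              ≈⟨ +-congˡ (-‿cong (+-cong (+-congʳ (pairing a)) (*-congˡ (+-congʳ (pairing b))))) ⟩
            ι u + ι 1ℤ * ι v - (px + ι (p · a) + d + ι 1ℤ * (px + ι (p · b) + d))
              ≈⟨ solve 7 (λ u v px a b c f →
                   u :+ (:1 :+ :0) :* v :- (px :+ a :+ (c :+ f :- px) :+ (:1 :+ :0) :* (px :+ b :+ (c :+ f :- px)))
                   := u :- f :+ (v :- f) :- ((a :+ c) :+ (b :+ c))) refl
                   (ι u) (ι v) px (ι (p · a)) (ι (p · b)) (ι c) (ι fx) ⟩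
            ι u - ι fx + (ι v - ι fx) - (ι (p · a) + ι c + (ι (p · b) + ι c))
              ≈⟨ +-cong (homo (u ℤ.- fx) (v ℤ.- fx) (ι-difference u fx) (ι-difference v fx))
                        (-‿cong (homo (p · a ℤ.+ c) (p · b ℤ.+ c) (ι-+ (p · a) c) (ι-+ (p · b) c))) ⟨
            ι ((u ℤ.- fx) ℤ.+ (v ℤ.- fx)) - ι ((p · a ℤ.+ c) ℤ.+ (p · b ℤ.+ c)) ∎))
      where
      px = ⟨ ι^ p , ι^ x ⟩
      -- Chosen so that the affine function takes the value p · y + c + fx at `x +ᵗ y`.
      d = ι c + ι fx - px

      homo : ∀ i j {a b} → ι i ≈ a → ι j ≈ b → ι (i ℤ.+ j) ≈ a + b
      homo i j i≈a j≈b = trans (ι-+ i j) (+-cong i≈a j≈b)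

      pairing : ∀ y → ⟨ ι^ p , ι^ (x +ᵗ y) ⟩ ≈ px + ι (p · y)
      pairing y = trans (⟨,⟩-+ᵗ (ι^ p) x y) (+-congˡ (ι-· p y))

      rearrange : ∀ k s t m → (k ℤ.+ s ℤ.- (k ℤ.+ t)) ℤ.+ + 2 ℤ.* (k ℤ.+ t ℤ.- m) ≡ s ℤ.+ t ℤ.+ + 2 ℤ.* (k ℤ.- m)
      rearrange = solve-∀

      rearrange′ : ∀ k s t r → s ℤ.+ t ℤ.+ + 2 ℤ.* (k ℤ.- (k ℤ.+ r)) ≡ s ℤ.+ t ℤ.- (r ℤ.+ r)
      rearrange′ = solve-∀

      -- `Within 1` concerns u + v - 2z. For u = x + a and v = x + b this is a + b + 2(x - z), and z
      -- = x + r turns it into the expression a + b - 2r of `Close`.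
      within : ∀ z → Scale.Within 1 (x +ᵗ a) (x +ᵗ b) z → ∀ i →
               ℤ.∣ toℤ (lookup a i) ℤ.+ toℤ (lookup b i) ℤ.+ + 2 ℤ.* (lookup x i ℤ.- lookup z i) ∣ ℕ.< 2
      within z near i = ≡.subst (λ e → ℤ.∣ e ∣ ℕ.< 2)
        (≡.trans (≡.cong₂ (λ k l → (k ℤ.- l) ℤ.+ + 2 ℤ.* (l ℤ.- lookup z i))
                          (lookup-zipWith _ i x a) (lookup-zipWith _ i x b))
                 (rearrange (lookup x i) (toℤ (lookup a i)) (toℤ (lookup b i)) (lookup z i)))
        (near i)

      ∣s+t∣≤2 : ∀ s t → ℤ.∣ toℤ s ℤ.+ toℤ t ∣ ℕ.≤ 2
      ∣s+t∣≤2 s t = ℕₚ.≤-trans (ℤₚ.∣i+j∣≤∣i∣+∣j∣ (toℤ s) (toℤ t)) (ℕₚ.+-mono-≤ (∣toℤ∣≤1 s) (∣toℤ∣≤1 t))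

      realMinorant : ∀ z → Scale.Within 1 (x +ᵗ a) (x +ᵗ b) z → just (⟨ ι^ p , ι^ z ⟩ + d) ≤⁺ toReal f z
      realMinorant z near with neighbour x z (λ i →
        ∣e+mw∣<m⇒∣w∣<2 1 (toℤ (lookup a i) ℤ.+ toℤ (lookup b i)) (lookup x i ℤ.- lookup z i)
          (∣s+t∣≤2 (lookup a i) (lookup b i)) (within z near i))
      ... | y , ≡.refl with f (x +ᵗ y) in eq
      ...   | nothing = _ SO.≤⊤⁺
      ...   | just w  = SO.[ ≤-via-difference (ι-mono-≤ (minorant (∈-localSystem⁺ eq) close)) (begin
        ι (w ℤ.- fx) - ι (p · y ℤ.+ c)        ≈⟨ +-cong (ι-difference w fx) (-‿cong (ι-+ (p · y) c)) ⟩
        ι w - ι fx - (ι (p · y) + ι c)        ≈⟨ solve 5 (λ w f y c px → w :- f :- (y :+ c) := w :- (px :+ y :+ (c :+ f :- px)))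
                                                   refl (ι w) (ι fx) (ι (p · y)) (ι c) px ⟩
        ι w - (px + ι (p · y) + d)            ≈⟨ +-congˡ (-‿cong (+-congʳ (pairing y))) ⟨
        ι w - (⟨ ι^ p , ι^ (x +ᵗ y) ⟩ + d)    ∎) ]
        where
        close : Near y a b
        close i = ≡.subst (λ e → ℤ.∣ e ∣ ℕ.< 2)
          (≡.trans (≡.cong (λ m → toℤ (lookup a i) ℤ.+ toℤ (lookup b i) ℤ.+ + 2 ℤ.* (lookup x i ℤ.- m)) (lookup-zipWith _ i x y))
                   (rearrange′ (lookup x i) (toℤ (lookup a i)) (toℤ (lookup b i)) (toℤ (lookup y i))))
          (within (x +ᵗ y) near i)

    module _ (fx≡ : f x ≡ just fx) (x∈dom : x ∈ dom (toReal f)) (value≡ : finiteValue x∈dom ≡ ι fx) where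

      ∂⇒rows : ∀ {p} → p ∈ ∂ (toReal f) x x∈dom → ∀ {y v} → (y , v) ∈ˡ localSystem → p ∙ y ≤ ι v
      ∂⇒rows {p} p∈∂ {y} ∈S with ∈-localSystem⁻ ∈S
      ... | w , fy≡w , ≡.refl with f (x +ᵗ y) | fy≡w | p∈∂ (x +ᵗ y)
      ...   | _ | ≡.refl | SO.[ ≤w ] = ≤-via-difference ≤w (begin
        ι w + - finiteValue x∈dom - ⟨ p , ι^ (x +ᵗ y) ⊖ ι^ x ⟩
          ≈⟨ +-cong (+-congˡ (-‿cong (reflexive value≡))) (-‿cong (trans (⟨,⟩-⊖ p _ _) (+-congʳ (⟨,⟩-+ᵗ p x y)))) ⟩
        ι w - ι fx - (⟨ p , ι^ x ⟩ + p ∙ y - ⟨ p , ι^ x ⟩)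
          ≈⟨ solve 4 (λ w f px py → w :- f :- (px :+ py :- px) := w :- f :- py) refl (ι w) (ι fx) ⟨ p , ι^ x ⟩ (p ∙ y) ⟩
        ι w - ι fx - p ∙ y
          ≈⟨ +-congʳ (ι-difference w fx) ⟨
        ι (w ℤ.- fx) - p ∙ y ∎)

      -- Near (z + k x) / (k + 1) the rows make the affine function through `fx` at `x` with slope
      -- `p` a minorant of `f`. In the resulting inequality the k-fold terms at `x` agree on both
      -- sides and cancel, which leaves the subgradient inequality at `z`.
      rows⇒∂ : ∀ {p} → (∀ {y v} → (y , v) ∈ˡ localSystem → p ∙ y ≤ ι v) → p ∈ ∂ (toReal f) x x∈dom
      rows⇒∂ {p} rows z with f z in fz≡
      ... | nothing = _ SO.≤⊤⁺
      ... | just w  = SO.[ ≤-via-difference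
        (minorant-scaled convex {z} {x} k p d (≡.cong (Maybe.map ι) fz≡) (≡.cong (Maybe.map ι) fx≡) minorant) (begin
        ι w + ι (+ k) * ι fx - (⟨ p , ι^ z ⟩ + d + ι (+ k) * (px + d))
          ≈⟨ solve 5 (λ w k f pz px → w :+ k :* f :- (pz :+ (f :- px) :+ k :* (px :+ (f :- px)))
                                   := w :- f :- (pz :- px)) refl (ι w) (ι (+ k)) (ι fx) ⟨ p , ι^ z ⟩ px ⟩
        ι w - ι fx - (⟨ p , ι^ z ⟩ - px)
          ≈⟨ +-cong (+-congˡ (-‿cong (reflexive value≡))) (-‿cong (⟨,⟩-⊖ p _ _)) ⟨
        ι w + - finiteValue x∈dom - ⟨ p , ι^ z ⊖ ι^ x ⟩ ∎) ]
        where
        px = ⟨ p , ι^ x ⟩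
        -- Makes the affine function equal to `ι fx` at `x`.
        d = ι fx - px
        -- With k at least the largest coordinate distance from `z` to `x`, the mixed point differs
        -- from `x` by less than 1 in each coordinate.
        distance = upperBound λ i → ℤ.∣ lookup z i ℤ.- lookup x i ∣
        k = proj₁ distance

        minorant : ∀ z′ → Scale.Within k z x z′ → just (⟨ p , ι^ z′ ⟩ + d) ≤⁺ toReal f z′
        minorant z′ near with neighbour x z′ (λ i → ∣e+mw∣<m⇒∣w∣<2 k (lookup z i ℤ.- lookup x i) (lookup x i ℤ.- lookup z′ i)
          (ℕₚ.m≤n⇒m≤1+n (proj₂ distance i)) (near i))
        ... | y , ≡.refl with f (x +ᵗ y) in eq
        ...   | nothing = _ SO.≤⊤⁺
        ...   | just u  = SO.[ ≤-via-difference (rows (∈-localSystem⁺ eq)) (begin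
          ι (u ℤ.- fx) - p ∙ y               ≈⟨ +-congʳ (ι-difference u fx) ⟩
          ι u - ι fx - p ∙ y                 ≈⟨ solve 4 (λ u f py px → u :- f :- py := u :- (px :+ py :+ (f :- px))) refl (ι u) (ι fx) (p ∙ y) px ⟩
          ι u - (px + p ∙ y + d)             ≈⟨ +-congˡ (-‿cong (+-congʳ (⟨,⟩-+ᵗ p x y))) ⟨
          ι u - (⟨ p , ι^ (x +ᵗ y) ⟩ + d)    ∎) ]

  finite : ∀ {e : ℤ ⁺} (e<⊤ : Maybe.map ι e <⁺ ⊤⁺) → ∃[ k ] e ≡ just k × finiteValue e<⊤ ≡ ι k
  finite {just k}  SS.[ _ ]<⊤⁺ = k , ≡.refl , ≡.refl
  finite {nothing} ()

  -- Polyhedra as finite lists of half-spaces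

  HalfSpace : ℕ → Set
  HalfSpace n = ℝ^ n × ℝ

  Satisfies : ℝ^ n → Pred (HalfSpace n) 0ℓ
  Satisfies p (a , b) = ⟨ a , p ⟩ ≤ b

  isPolyhedron : ∀ {P : Pred (ℝ^ n) 0ℓ} (hs : List (HalfSpace n)) →
                 (∀ p → p ∈ P ⇔ All (Satisfies p) hs) → IsPolyhedron P
  isPolyhedron hs P⇔ = List.length hs , proj₁ ∘ List.lookup hs , proj₂ ∘ List.lookup hs , λ p → mk⇔
    (λ p∈P k → All.lookup (Equivalence.to (P⇔ p) p∈P) (∈-lookup k))
    (λ sat → Equivalence.from (P⇔ p) (All.tabulate λ h∈ →
      ≡.subst (Satisfies p) (≡.sym (lookup-index h∈)) (sat (Any.index h∈))))

  single : ℝ → Fin n → ℝ^ n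
  single c zero    = c Vector.∷ λ _ → 0#
  single c (suc i) = 0# Vector.∷ single c i

  ⟨0,⟩ : ∀ (p : ℝ^ n) → ⟨ (λ _ → 0#) , p ⟩ ≈ 0#
  ⟨0,⟩ {ℕ.zero}  p = refl
  ⟨0,⟩ {ℕ.suc n} p = trans (+-cong (zeroˡ _) (⟨0,⟩ (Vector.tail p))) (+-identityʳ 0#)

  ⟨single,⟩ : ∀ c i (p : ℝ^ n) → ⟨ single c i , p ⟩ ≈ c * p i
  ⟨single,⟩ c zero    p = trans (+-congˡ (⟨0,⟩ (Vector.tail p))) (+-identityʳ _)
  ⟨single,⟩ c (suc i) p = trans (+-cong (zeroˡ _) (⟨single,⟩ c i (Vector.tail p))) (+-identityˡ _)

  rowHalfSpace : Row n → HalfSpace n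
  rowHalfSpace (y , v) = (λ i → ι (toℤ (lookup y i))) , ι v

  lowerHalfSpace : Fin n → ℤ ₋ → List (HalfSpace n)
  lowerHalfSpace i (just a) = (single (- 1#) i , - ι a) ∷ []
  lowerHalfSpace i nothing  = []

  upperHalfSpace : Fin n → ℤ ⁺ → List (HalfSpace n)
  upperHalfSpace i (just b) = (single 1# i , ι b) ∷ []
  upperHalfSpace i nothing  = []

  lower⇔ : ∀ (p : ℝ^ n) i a → Maybe.map ι a ≤₋ just (p i) ⇔ All (Satisfies p) (lowerHalfSpace i a)
  lower⇔ p i nothing  = mk⇔ (λ _ → []) (λ _ → IO.⊥₋≤ _)
  lower⇔ p i (just a) = mk⇔
    (λ { IO.[ a≤p ] → ≤-via-difference a≤p (sym difference) ∷ [] })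
    (λ { (≤-a ∷ []) → IO.[ ≤-via-difference ≤-a difference ] })
    where
    difference : - ι a - ⟨ single (- 1#) i , p ⟩ ≈ p i - ι a
    difference = trans (+-congˡ (-‿cong (⟨single,⟩ (- 1#) i p)))
      (solve 2 (λ a p → :- a :- (:- :1) :* p := p :- a) refl (ι a) (p i))

  upper⇔ : ∀ (p : ℝ^ n) i b → just (p i) ≤⁺ Maybe.map ι b ⇔ All (Satisfies p) (upperHalfSpace i b)
  upper⇔ p i nothing  = mk⇔ (λ _ → []) (λ _ → _ SO.≤⊤⁺)
  upper⇔ p i (just b) = mk⇔
    (λ { SO.[ p≤b ] → ≤-trans (≤-reflexive eq) p≤b ∷ [] })
    (λ { (≤b ∷ []) → SO.[ ≤-trans (≤-reflexive (sym eq)) ≤b ] })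
    where
    eq : ⟨ single 1# i , p ⟩ ≈ p i
    eq = trans (⟨single,⟩ 1# i p) (*-identityˡ _)

  module _ (S : System n) (α : Vector (ℤ ₋) n) (β : Vector (ℤ ⁺) n) where

    boundHalfSpaces : Fin n → List (HalfSpace n)
    boundHalfSpaces i = lowerHalfSpace i (α i) List.++ upperHalfSpace i (β i)

    halfSpaces : List (HalfSpace n)
    halfSpaces = List.map rowHalfSpace S List.++ List.concat (List.tabulate boundHalfSpaces)

    realSolution⇔ : ∀ p → p ∈ RealSolution S α β ⇔ All (Satisfies p) halfSpaces
    realSolution⇔ p = mk⇔
      (λ (solves rows bounds) → Allₚ.++⁺
        (Allₚ.map⁺ (All.tabulate λ {(y , _)} ∈S → ≤-trans (≤-reflexive (comm y)) (rows ∈S)))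
        (Allₚ.concat⁺ (Allₚ.tabulate⁺ λ i → Allₚ.++⁺
          (Equivalence.to (lower⇔ p i (α i)) (proj₁ (bounds i)))
          (Equivalence.to (upper⇔ p i (β i)) (proj₂ (bounds i))))))
      (λ sat →
        let bounds = λ i → Allₚ.++⁻ (lowerHalfSpace i (α i))
                     (Allₚ.tabulate⁻ (Allₚ.concat⁻ (Allₚ.++⁻ʳ (List.map rowHalfSpace S) sat)) i)
        in solves
          (λ {y} ∈S → ≤-trans (≤-reflexive (sym (comm y)))
            (All.lookup (Allₚ.map⁻ (Allₚ.++⁻ˡ (List.map rowHalfSpace S) sat)) ∈S))
          (λ i → Equivalence.from (lower⇔ p i (α i)) (proj₁ (bounds i)) ,
                 Equivalence.from (upper⇔ p i (β i)) (proj₂ (bounds i))))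
      where
      comm : ∀ y → ⟨ (λ i → ι (toℤ (lookup y i))) , p ⟩ ≈ p ∙ y
      comm y = sum-cong-≋ λ i → *-comm (ι (toℤ (lookup y i))) (p i)

  boxConsistent : (B : IntegralBox n) → ConsistentBounds (IntegralBox.α B) (IntegralBox.β B)
  boxConsistent B i a≡k b≡l with IntegralBox.α B i | IntegralBox.β B i | IntegralBox.α≤β B i
  boxConsistent B i ≡.refl ≡.refl | _ | _ | SO.[ IO.[ k≤l ] ] = k≤l

-- Subdifferentials intersected with integral boxes

theorem1p2 : (R : RealNumbers) → let open IntegralConvexity R in
    (n : ℕ) (f : ℤ^ n → ℤ ⁺) → IntegrallyConvex (toReal f) →
    (x : ℤ^ n) (x∈dom : x ∈ dom (toReal f)) (B : IntegralBox n) →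
    let P = ∂ (toReal f) x x∈dom ∩ ⟦ B ⟧ in
    Satisfiable P →
    (IsPolyhedron P × (∃[ z ] ι^ z ∈ P)) ×
    (Bounded P → ∃[ z ] IsVertex P (ι^ z))
theorem1p2 R n f convex x x∈dom B (p₀ , p₀∈P) with Subdifferential.finite R x∈dom
... | fx , fx≡ , value≡ =
  (polyhedron , (let z , solution = integralSolution consistent midpoint nonempty
                 in z , fromSolution (fromIntegral solution))) ,
  λ (M , ∣p∣≤M) →
    let z , solution , extreme = extremeSolution {M = M} consistent midpoint nonempty
          -- Boundedness controls absolute values, and hence gives the upper bound on coordinates
          -- that `extremeSolution` asks for.
          λ {z} solution i → ≤-trans (x≤x⊔y _ _)
                                     (∣p∣≤M (fromSolution (fromIntegral solution)) i)
    in z , fromSolution (fromIntegral solution) ,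
       λ {p} {q} {t} p∈P q∈P → extreme {p} {q} {t} (toSolution p∈P) (toSolution q∈P)
  where
  open RealNumbers R using (totalOrder; _≤_)
  open IntegralConvexity R
  open RealFacts R
  open RealSolutions R
  open Subdifferential R
  open Max totalOrder using (x≤x⊔y)
  open LocalSystem f x fx
  open IntegralBox B

  P : Pred (ℝ^ n) 0ℓ
  P = ∂ (toReal f) x x∈dom ∩ ⟦ B ⟧

  consistent = boxConsistent B

  midpoint : MidpointConvex localSystem
  midpoint = localSystem-midpointConvex f convex x

  toSolution : ∀ {p} → p ∈ P → p ∈ RealSolution localSystem α β
  toSolution (p∈∂ , p∈B) = solves (∂⇒rows f convex x fx≡ x∈dom value≡ p∈∂) p∈B

  fromSolution : ∀ {p} → p ∈ RealSolution localSystem α β → p ∈ P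
  fromSolution (solves rows bounds) = rows⇒∂ f convex x fx≡ x∈dom value≡ rows , bounds

  nonempty : Satisfiable (RealSolution localSystem α β)
  nonempty = p₀ , toSolution p₀∈P

  polyhedron : IsPolyhedron P
  polyhedron = isPolyhedron (halfSpaces localSystem α β) λ p →
    let open Equivalence (realSolution⇔ localSystem α β p) in
    mk⇔ (λ p∈P → to (toSolution p∈P)) (λ sat → fromSolution (from sat))
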